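{- Let $p$ be a prime, let $1\le k\le n$ be integers, and let $A$ be a set of $n$ distinct nonzero residue classes $a_1,\dots,a_n$ modulo $p$ such that $a_i+a_j\neq 0$ for all $1\le i,j\le n$. If $$p>2k(n-k)+\binom{k+1}{2},$$ then $$\left|\left\{\sum_{i\in I}\pm a_i \;:\; I\subset\{1,\dots,n\},\ |I|=k\right\}\right|>2k(n-k)+\binom{k+1}{2},$$ where for each $I$ all $2^k$ choices of signs are allowed.
   Context: The set on the left consists of all residues $\sum_{i\in I}\varepsilon_i a_i \pmod p$ with $I$ a $k$-element subset of $\{1,\dots,n\}$ and $\varepsilon_i\in\{ -1,+1\}$. -}

module Defs where

open import Data.Nat using (ℕ; zero; suc; _+_; _*_; _∸_)
open import Data.Nat.Combinatorics using (_C_)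
open import Data.Bool using (Bool; true; false)
open import Data.Fin using (Fin; toℕ) renaming (zero to fzero; suc to fsuc)
open import Data.Fin.Subset using (Subset; ∣_∣; inside; outside)
open import Data.Vec using (Vec; []; _∷_)
open import Data.Integer as ℤ using (ℤ; +_; -_)
open import Data.Integer.Divisibility using (_∣_)
open import Data.Product using (Σ; _×_; ∃)
open import Function.Definitions using (Injective)
open import Relation.Binary.PropositionalEquality using (_≡_)

signedSum : ∀ {n} → Subset n → (Fin n → Bool) → (Fin n → ℤ) → ℤ
signedSum [] ε a = + 0
signedSum (inside ∷ I) ε a =
  (if' (ε fzero) (a fzero)) ℤ.+ signedSum I (λ i → ε (fsuc i)) (λ i → a (fsuc i))
  where
  if' : Bool → ℤ → ℤ
  if' true x = x
  if' false x = - x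
signedSum (outside ∷ I) ε a = signedSum I (λ i → ε (fsuc i)) (λ i → a (fsuc i))

_≡[mod_]_ : ℤ → ℕ → ℤ → Set
x ≡[mod p ] y = (+ p) ∣ (x ℤ.- y)

InSignedSumset : (p n k : ℕ) → (Fin n → ℤ) → Fin p → Set
InSignedSumset p n k a r =
  Σ (Subset n) λ I → Σ (Fin n → Bool) λ ε →
    (∣ I ∣ ≡ k) × (signedSum I ε a ≡[mod p ] (+ toℕ r))

CardGreaterThan : (p : ℕ) → (Fin p → Set) → ℕ → Set
CardGreaterThan p S m =
  Σ (Fin (suc m) → Fin p) λ f → Injective _≡_ _≡_ f × (∀ j → S (f j))

bound : ℕ → ℕ → ℕ
bound n k = 2 * k * (n ∸ k) + (suc k) C 2

{-# OPTIONS --safe #-}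

-- Let B = {±a₁, …, ±aₙ} and d = 2n - 1.  If the signed sums were all contained in a list C of m = bound n k
-- residues, then, with S = x₁ + … + x_k, the polynomial
--   P = ∏_{c ∈ C} (S - c) · ∏ᵢ xᵢⁱ · det (xᵢ²ʲ)     (0 ≤ i , j < k)
-- would vanish modulo p on B ^ k, because the Vandermonde factor kills the tuples using some aᵢ twice.
-- An integer multiple L of the divided difference on B has zero moments below d, so the functional L ⊗ … ⊗ L
-- extracts from P, whose degree is k d, a multiple of the coefficient of ∏ᵢ xᵢᵈ.  Expanding the determinant
-- and S ^ m, this coefficient is a determinant of falling factorials in the numbers d - 2j, hence again a
-- Vandermonde determinant, and all its factors are nonzero modulo p.
--
-- Everything except this last vanishing and nonvanishing takes place over ℤ, with divisions cleared.

module Submission where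

open import Defs
open import Data.Nat using (ℕ; _≤_; _>_)
open import Data.Nat.Primality using (Prime)
open import Data.Fin using (Fin)
open import Data.Integer using (ℤ; +_; _+_)
open import Relation.Binary.PropositionalEquality using (_≡_; _≢_)
open import Relation.Nullary using (¬_)

open import Data.Bool using (Bool; true; false)
import Data.Fin as Fin
import Data.Fin.Properties as Fin
open import Data.Fin.Subset using (Subset; ∣_∣; inside; outside) renaming (⊥ to ∅)
import Data.Fin.Subset.Properties as Subset
open import Data.Integer using (-[1+_]; _*_; _-_; -_; 0ℤ; 1ℤ; -1ℤ; _^_)
open import Data.Integer.Divisibility using (_∣_)
import Data.Integer.Divisibility.Signed as Signed
open import Data.Integer.DivMod using (_%ℕ_; _/ℕ_; n%ℕd<d; a≡a%ℕn+[a/ℕn]*n)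
import Data.Integer.Properties as ℤ
open import Data.Integer.Tactic.RingSolver using (solve-∀)
open import Data.List using (List; []; _∷_; _++_; length; map; upTo; zipWith; allFin; drop;
  cartesianProduct; cartesianProductWith; filter; deduplicate; lookup; replicate)
open import Data.List.Membership.Propositional using (_∈_)
import Data.List.Membership.Propositional.Properties as List
import Data.List.Properties as List
open import Data.List.Relation.Unary.All as All using (All; []; _∷_)
import Data.List.Relation.Unary.All.Properties as All
open import Data.List.Relation.Unary.AllPairs as AllPairs using (AllPairs; []; _∷_)
import Data.List.Relation.Unary.AllPairs.Properties as AllPairs
open import Data.List.Relation.Unary.Any as Any using (Any; here; there)
open import Data.List.Relation.Unary.Unique.DecPropositional.Properties using (deduplicate-!)
open import Data.List.Relation.Unary.Unique.Propositional using (Unique)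
import Data.List.Relation.Unary.Unique.Propositional.Properties as Unique
open import Data.Nat as ℕ using (zero; suc; _!; _<_; s≤s; z≤n; NonZero)
open import Data.Nat.Combinatorics using (_C_; nC1≡n; nCk+nC[k+1]≡[n+1]C[k+1])
import Data.Nat.Divisibility as ℕ
open import Data.Nat.ListAction using (sum)
import Data.Nat.ListAction.Properties as ListAction
open import Data.Nat.Primality using (euclidsLemma; prime⇒nonZero; prime⇒nonTrivial)
import Data.Nat.Properties as ℕ
import Data.Nat.Tactic.RingSolver as ℕ-Solver
open import Data.Product using (∃; _×_; _,_; proj₁; proj₂)
open import Data.Sum using (_⊎_; inj₁; inj₂)
open import Data.Vec as Vec using ([]; _∷_)
open import Data.Vec.Functional using (updateAt)
import Data.Vec.Properties as Vec
open import Function using (_∘_; id; const; case_of_)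
open import Relation.Binary using (tri<; tri≈; tri>)
open import Relation.Binary.PropositionalEquality using (refl; sym; trans; cong; cong₂; subst; subst₂; module ≡-Reasoning)
open import Relation.Nullary using (Dec; yes; no; ¬?; contradiction)

open ≡-Reasoning

-- Formal linear combinations

-- The bound is dictated by degrees. The monomial ∏ xᵢⁱ contributes C(k,2) and the determinant 2
-- C(k,2), and 2k(n - k) + C(k+1,2) + 3 C(k,2) = k (2n - 1); so exactly m factors S - c bring the
-- degree to k d.
--
-- The determinant is a Vandermonde determinant in the squares xᵢ², which is why it does not
-- distinguish x from -x. By itself it would not suffice: its product with a symmetric polynomial is
-- alternating, and for k ≥ 2 the symmetric monomial ∏ xᵢᵈ has coefficient 0 in an alternating
-- polynomial. The factor ∏ xᵢⁱ breaks this symmetry, and its exponents 0, ..., k - 1 are chosen so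
-- that the multinomial coefficients m! / ∏ (d - 2wᵢ - i)!, summed with signs over the permutations
-- w, form a determinant that can be evaluated.
--
-- The size of p enters through m!, which must be prime to p, and through d ≤ m < p, which keeps the
-- falling factorials nonzero. The condition aᵢ + aⱼ ≠ 0 separates the 2n elements of B and makes p
-- odd.

Comb : Set → Set
Comb A = List (ℤ × A)

-- Functionals on functions of atoms or tuples and signed sums over permutations are both paired
-- with functions in this way, so a single Fubini rule `∑-swap` interchanges any two of them.
∑ : ∀ {A : Set} → Comb A → (A → ℤ) → ℤ
∑ [] f = 0ℤ
∑ ((w , a) ∷ l) f = w * f a + ∑ l f

On : ∀ {A : Set} → (A → Set) → Comb A → Set
On P = All (P ∘ proj₂)

weigh : ∀ {A B : Set} → ℤ → (A → B) → Comb A → Comb B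
weigh c g = map (λ (w , a) → c * w , g a)

bind : ∀ {A B : Set} → Comb A → (A → Comb B) → Comb B
bind [] k = []
bind ((w , a) ∷ l) k = weigh w id (k a) ++ bind l k

∑-congOn : ∀ {A : Set} {f g : A → ℤ} {l} → On (λ a → f a ≡ g a) l → ∑ l f ≡ ∑ l g
∑-congOn [] = refl
∑-congOn {l = (w , _) ∷ _} (e ∷ es) = cong₂ (λ x y → w * x + y) e (∑-congOn es)

always : ∀ {A : Set} {P : A → Set} (l : Comb A) → (∀ a → P a) → On P l
always l h = All.universal (h ∘ proj₂) l

∑-cong : ∀ {A : Set} {f g : A → ℤ} (l : Comb A) → (∀ a → f a ≡ g a) → ∑ l f ≡ ∑ l g
∑-cong l h = ∑-congOn (always l h)

∑-zero : ∀ {A : Set} {f : A → ℤ} {l} → On (λ a → f a ≡ 0ℤ) l → ∑ l f ≡ 0ℤ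
∑-zero [] = refl
∑-zero {l = (w , _) ∷ _} (e ∷ es) = trans (cong₂ (λ x y → w * x + y) e (∑-zero es)) (lem w)
  where
  lem : ∀ w → w * 0ℤ + 0ℤ ≡ 0ℤ
  lem = solve-∀

∑-+ : ∀ {A : Set} (l : Comb A) (f g : A → ℤ) → ∑ l (λ a → f a + g a) ≡ ∑ l f + ∑ l g
∑-+ [] f g = refl
∑-+ ((w , a) ∷ l) f g = trans (cong (_+_ (w * (f a + g a))) (∑-+ l f g)) (lem w (f a) (g a) (∑ l f) (∑ l g))
  where
  lem : ∀ w x y X Y → w * (x + y) + (X + Y) ≡ w * x + X + (w * y + Y)
  lem = solve-∀

∑-* : ∀ {A : Set} (l : Comb A) (c : ℤ) (f : A → ℤ) → ∑ l (λ a → c * f a) ≡ c * ∑ l f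
∑-* [] c f = sym (ℤ.*-zeroʳ c)
∑-* ((w , a) ∷ l) c f = trans (cong (_+_ (w * (c * f a))) (∑-* l c f)) (lem w c (f a) (∑ l f))
  where
  lem : ∀ w c x X → w * (c * x) + c * X ≡ c * (w * x + X)
  lem = solve-∀

∑-neg : ∀ {A : Set} (l : Comb A) (f : A → ℤ) → ∑ l (λ a → - f a) ≡ - ∑ l f
∑-neg l f = begin
  ∑ l (λ a → - f a)      ≡⟨ ∑-cong l (λ a → ℤ.-1*i≡-i (f a)) ⟨
  ∑ l (λ a → -1ℤ * f a)  ≡⟨ ∑-* l -1ℤ f ⟩
  -1ℤ * ∑ l f            ≡⟨ ℤ.-1*i≡-i _ ⟩
  - ∑ l f                ∎

∑-- : ∀ {A : Set} (l : Comb A) (f g : A → ℤ) → ∑ l (λ a → f a - g a) ≡ ∑ l f - ∑ l g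
∑-- l f g = trans (∑-+ l f (λ a → - g a)) (cong (_+_ (∑ l f)) (∑-neg l g))

∑-swap : ∀ {A B : Set} (l : Comb A) (m : Comb B) (f : A → B → ℤ) →
  ∑ l (λ a → ∑ m (f a)) ≡ ∑ m (λ b → ∑ l (λ a → f a b))
∑-swap [] m f = sym (∑-zero (always m (λ _ → refl)))
∑-swap ((w , a) ∷ l) m f = begin
  w * ∑ m (f a) + ∑ l (λ a′ → ∑ m (f a′))
    ≡⟨ cong₂ _+_ (sym (∑-* m w (f a))) (∑-swap l m f) ⟩
  ∑ m (λ b → w * f a b) + ∑ m (λ b → ∑ l (λ a′ → f a′ b))
    ≡⟨ ∑-+ m _ _ ⟨
  ∑ m (λ b → w * f a b + ∑ l (λ a′ → f a′ b))  ∎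

∑-weigh : ∀ {A B : Set} (c : ℤ) (g : A → B) (l : Comb A) (f : B → ℤ) → ∑ (weigh c g l) f ≡ c * ∑ l (f ∘ g)
∑-weigh c g [] f = sym (ℤ.*-zeroʳ c)
∑-weigh c g ((w , a) ∷ l) f =
  trans (cong (_+_ (c * w * f (g a))) (∑-weigh c g l f)) (lem c w (f (g a)) (∑ l (f ∘ g)))
  where
  lem : ∀ c w x X → c * w * x + c * X ≡ c * (w * x + X)
  lem = solve-∀

∑-++ : ∀ {A : Set} (l m : Comb A) (f : A → ℤ) → ∑ (l ++ m) f ≡ ∑ l f + ∑ m f
∑-++ [] m f = sym (ℤ.+-identityˡ _)
∑-++ ((w , a) ∷ l) m f = trans (cong (_+_ (w * f a)) (∑-++ l m f)) (sym (ℤ.+-assoc (w * f a) _ _))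

∑-bind : ∀ {A B : Set} (l : Comb A) (k : A → Comb B) (f : B → ℤ) → ∑ (bind l k) f ≡ ∑ l (λ a → ∑ (k a) f)
∑-bind [] k f = refl
∑-bind ((w , a) ∷ l) k f =
  trans (∑-++ (weigh w id (k a)) _ f) (cong₂ _+_ (∑-weigh w id (k a) f) (∑-bind l k f))

On-weigh : ∀ {A B : Set} {P : A → Set} {Q : B → Set} c (g : A → B) {l} →
  (∀ {a} → P a → Q (g a)) → On P l → On Q (weigh c g l)
On-weigh c g h p = All.map⁺ (All.map h p)

On-bind : ∀ {A B : Set} {P : A → Set} {Q : B → Set} {l} {k : A → Comb B} →
  (∀ {a} → P a → On Q (k a)) → On P l → On Q (bind l k)
On-bind h [] = []
On-bind {l = (w , _) ∷ _} h (p ∷ ps) = All.++⁺ (On-weigh w id id (h p)) (On-bind h ps)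

-- Laplace expansion

-- The weights are Laplace signs: removing the entry at position r, counted from 0, has weight
-- (-1)^r.
pick : ∀ {I : Set} → List I → Comb (I × List I)
pick [] = []
pick (i ∷ is) = (1ℤ , i , is) ∷ weigh -1ℤ (λ (j , js) → j , i ∷ js) (pick is)

∑-pick : ∀ {I : Set} (i : I) is (T : I × List I → ℤ) →
  ∑ (pick (i ∷ is)) T ≡ T (i , is) - ∑ (pick is) (λ (j , js) → T (j , i ∷ js))
∑-pick i is T = trans (cong (_+_ (1ℤ * T (i , is))) (∑-weigh -1ℤ _ (pick is) T)) (lem (T (i , is)) _)
  where
  lem : ∀ x X → 1ℤ * x + -1ℤ * X ≡ x - X
  lem = solve-∀

-- Any quantity that is invariant under exchanging neighbours is invariant under moving an entry to the front.
On-pick : ∀ {I S : Set} (h : List I → S) (c : I → S → S) → (∀ i is → h (i ∷ is) ≡ c i (h is)) →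
  (∀ i j s → c i (c j s) ≡ c j (c i s)) →
  ∀ is → On (λ (j , js) → c j (h js) ≡ h is) (pick is)
On-pick h c cons comm [] = []
On-pick h c cons comm (i ∷ is) = sym (cons i is) ∷ On-weigh -1ℤ (λ (j , js) → j , i ∷ js)
  (λ {(j , js)} e → begin
    c j (h (i ∷ js))  ≡⟨ cong (c j) (cons i js) ⟩
    c j (c i (h js))  ≡⟨ comm j i _ ⟩
    c i (c j (h js))  ≡⟨ cong (c i) e ⟩
    c i (h is)        ≡⟨ cons i is ⟨
    h (i ∷ is)        ∎)
  (On-pick h c cons comm is)

pick-length : ∀ {I : Set} (is : List I) → On (λ (_ , js) → suc (length js) ≡ length is) (pick is)
pick-length = On-pick length (λ _ → suc) (λ _ _ → refl) (λ _ _ _ → refl)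

-- Of two removals, the one nearer the front shifts the position of the other by one exactly when it
-- is done first. Exchanging the order therefore flips the sign.
∑-pick₂-antisym : ∀ {I : Set} (is : List I) (T : I → I → List I → ℤ) →
  ∑ (pick is) (λ (i , is′) → ∑ (pick is′) (λ (j , js) → T i j js)) ≡
  - ∑ (pick is) (λ (i , is′) → ∑ (pick is′) (λ (j , js) → T j i js))
∑-pick₂-antisym [] T = refl
∑-pick₂-antisym (a ∷ is) T = begin
  ∑ (pick (a ∷ is)) (λ (i , is′) → ∑ (pick is′) (λ (j , js) → T i j js))
    ≡⟨ expand T ⟩
  ∑ (pick is) (λ (j , js) → T a j js) - (∑ (pick is) (λ (j , js) → T j a js)
    - ∑ (pick is) (λ (i , is′) → ∑ (pick is′) (λ (j , js) → T i j (a ∷ js))))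
    ≡⟨ cong (λ x → X - (Y - x)) (∑-pick₂-antisym is (λ i j js → T i j (a ∷ js))) ⟩
  X - (Y - - Z)
    ≡⟨ lem X Y Z ⟩
  - (Y - (X - Z))
    ≡⟨ cong -_ (expand (λ i j js → T j i js)) ⟨
  - ∑ (pick (a ∷ is)) (λ (i , is′) → ∑ (pick is′) (λ (j , js) → T j i js)) ∎
  where
  X = ∑ (pick is) (λ (j , js) → T a j js)
  Y = ∑ (pick is) (λ (j , js) → T j a js)
  Z = ∑ (pick is) (λ (i , is′) → ∑ (pick is′) (λ (j , js) → T j i (a ∷ js)))
  lem : ∀ x y z → x - (y - - z) ≡ - (y - (x - z))
  lem = solve-∀
  expand : ∀ T → ∑ (pick (a ∷ is)) (λ (i , is′) → ∑ (pick is′) (λ (j , js) → T i j js)) ≡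
    ∑ (pick is) (λ (j , js) → T a j js) - (∑ (pick is) (λ (j , js) → T j a js)
      - ∑ (pick is) (λ (i , is′) → ∑ (pick is′) (λ (j , js) → T i j (a ∷ js))))
  expand T = trans (∑-pick a is (λ (i , is′) → ∑ (pick is′) (λ (j , js) → T i j js))) (cong (_-_ (∑ (pick is) (λ (j , js) → T a j js)))
    (trans (∑-cong (pick is) (λ (i , is′) → ∑-pick a is′ (λ (j , js) → T i j js)))
      (∑-- (pick is) _ _)))

-- Signed permutations of a list of length n. For any other length the combination is empty, so
-- non-square determinants are 0 and row and column expansion hold without length hypotheses.
alt : ∀ {I : Set} → ℕ → List I → Comb (List I)
alt zero [] = (1ℤ , []) ∷ []
alt zero (_ ∷ _) = []
alt (suc n) is = bind (pick is) (λ (i , is′) → weigh 1ℤ (i ∷_) (alt n is′))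

entries : ∀ {J I : Set} → (J → I → ℤ) → List J → List I → ℤ
entries E (j ∷ js) (i ∷ is) = E j i * entries E js is
entries E _ _ = 1ℤ

det : ∀ {J I : Set} → (J → I → ℤ) → List J → List I → ℤ
det E js is = ∑ (alt (length js) is) (entries E js)

det-row : ∀ {J I : Set} (E : J → I → ℤ) j js is →
  det E (j ∷ js) is ≡ ∑ (pick is) (λ (i , is′) → E j i * det E js is′)
det-row E j js is = trans (∑-bind (pick is) _ (entries E (j ∷ js))) (∑-cong (pick is) (λ (i , is′) → begin
  ∑ (weigh 1ℤ (i ∷_) (alt (length js) is′)) (entries E (j ∷ js))
    ≡⟨ ∑-weigh 1ℤ (i ∷_) (alt (length js) is′) (entries E (j ∷ js)) ⟩
  1ℤ * ∑ (alt (length js) is′) (λ w → E j i * entries E js w)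
    ≡⟨ ℤ.*-identityˡ _ ⟩
  ∑ (alt (length js) is′) (λ w → E j i * entries E js w)
    ≡⟨ ∑-* (alt (length js) is′) (E j i) _ ⟩
  E j i * det E js is′ ∎))

-- Expand along the first row and each minor along its first column by induction; interchanging the
-- two sums exposes a row expansion that can be folded back.
det-col : ∀ {J I : Set} (E : J → I → ℤ) js i is →
  det E js (i ∷ is) ≡ ∑ (pick js) (λ (j , js′) → E j i * det E js′ is)
det-col E [] i is = refl
det-col E (j ∷ js) i is = begin
  det E (j ∷ js) (i ∷ is)
    ≡⟨ trans (det-row E j js (i ∷ is)) (∑-pick i is (λ (i′ , is′) → E j i′ * det E js is′)) ⟩
  E j i * det E js is - ∑ (pick is) (λ (i′ , is′) → E j i′ * det E js (i ∷ is′))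
    ≡⟨ cong (_-_ (E j i * det E js is)) (begin
      ∑ (pick is) (λ (i′ , is′) → E j i′ * det E js (i ∷ is′))
        ≡⟨ ∑-cong (pick is) (λ (i′ , is′) → trans (cong (E j i′ *_) (det-col E js i is′))
             (sym (∑-* (pick js) (E j i′) _))) ⟩
      ∑ (pick is) (λ (i′ , is′) → ∑ (pick js) (λ (j′ , js′) → E j i′ * (E j′ i * det E js′ is′)))
        ≡⟨ ∑-swap (pick is) (pick js) _ ⟩
      ∑ (pick js) (λ (j′ , js′) → ∑ (pick is) (λ (i′ , is′) → E j i′ * (E j′ i * det E js′ is′)))
        ≡⟨ ∑-cong (pick js) (λ (j′ , js′) → trans
             (∑-cong (pick is) (λ (i′ , is′) → lem (E j i′) (E j′ i) (det E js′ is′)))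
             (trans (∑-* (pick is) (E j′ i) _) (cong (E j′ i *_) (sym (det-row E j js′ is))))) ⟩
      ∑ (pick js) (λ (j′ , js′) → E j′ i * det E (j ∷ js′) is) ∎) ⟩
  E j i * det E js is - ∑ (pick js) (λ (j′ , js′) → E j′ i * det E (j ∷ js′) is)
    ≡⟨ ∑-pick j js (λ (j′ , js′) → E j′ i * det E js′ is) ⟨
  ∑ (pick (j ∷ js)) (λ (j′ , js′) → E j′ i * det E js′ is) ∎
  where
  lem : ∀ x y z → x * (y * z) ≡ y * (x * z)
  lem = solve-∀

det-transpose : ∀ {J I : Set} (E : J → I → ℤ) js is → det E js is ≡ det (λ i j → E j i) is js
det-transpose E [] [] = refl
det-transpose E [] (i ∷ is) = sym (trans (det-row (λ i j → E j i) i is []) refl)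
det-transpose E (j ∷ js) is = begin
  det E (j ∷ js) is                                        ≡⟨ det-row E j js is ⟩
  ∑ (pick is) (λ (i , is′) → E j i * det E js is′)         ≡⟨ ∑-cong (pick is) (λ (i , is′) → cong (E j i *_) (det-transpose E js is′)) ⟩
  ∑ (pick is) (λ (i , is′) → E j i * det (λ i j → E j i) is′ js) ≡⟨ det-col (λ i j → E j i) is j js ⟨
  det (λ i j → E j i) is (j ∷ js)                          ∎

det-cong : ∀ {J I : Set} {E F : J → I → ℤ} → (∀ j i → E j i ≡ F j i) → ∀ js is → det E js is ≡ det F js is
det-cong {E = E} {F} h js is = ∑-cong (alt (length js) is) (go js)
  where
  go : ∀ js is → entries E js is ≡ entries F js is
  go [] _ = refl
  go (j ∷ js) [] = refl
  go (j ∷ js) (i ∷ is) = cong₂ _*_ (h j i) (go js is)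

det-map-rows : ∀ {K J I : Set} (E : J → I → ℤ) (φ : K → J) ks is → det E (map φ ks) is ≡ det (E ∘ φ) ks is
det-map-rows E φ [] is = ∑-cong (alt 0 is) (λ { [] → refl ; (_ ∷ _) → refl })
det-map-rows E φ (k ∷ ks) is = begin
  det E (map φ (k ∷ ks)) is                                    ≡⟨ det-row E (φ k) (map φ ks) is ⟩
  ∑ (pick is) (λ (i , is′) → E (φ k) i * det E (map φ ks) is′) ≡⟨ ∑-cong (pick is) (λ (i , is′) → cong (E (φ k) i *_) (det-map-rows E φ ks is′)) ⟩
  ∑ (pick is) (λ (i , is′) → E (φ k) i * det (E ∘ φ) ks is′)   ≡⟨ det-row (E ∘ φ) k ks is ⟨
  det (E ∘ φ) (k ∷ ks) is                                      ∎

det-map-cols : ∀ {K J I : Set} (E : J → I → ℤ) (φ : K → I) js ks →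
  det E js (map φ ks) ≡ det (λ j k → E j (φ k)) js ks
det-map-cols E φ js ks = begin
  det E js (map φ ks)                ≡⟨ det-transpose E js (map φ ks) ⟩
  det (λ i j → E j i) (map φ ks) js  ≡⟨ det-map-rows (λ i j → E j i) φ ks js ⟩
  det (λ k j → E j (φ k)) ks js      ≡⟨ det-transpose (λ j k → E j (φ k)) js ks ⟨
  det (λ j k → E j (φ k)) js ks      ∎

∏ : ∀ {A : Set} → (A → ℤ) → List A → ℤ
∏ g [] = 1ℤ
∏ g (x ∷ xs) = g x * ∏ g xs

pick-∏ : ∀ {I : Set} (g : I → ℤ) is → On (λ (i , is′) → g i * ∏ g is′ ≡ ∏ g is) (pick is)
pick-∏ g = On-pick (∏ g) (λ i s → g i * s) (λ _ _ → refl) (λ i j s → lem (g i) (g j) s)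
  where
  lem : ∀ x y z → x * (y * z) ≡ y * (x * z)
  lem = solve-∀

det-scale-cols : ∀ {J I : Set} (g : I → ℤ) (E : J → I → ℤ) js is → length js ≡ length is →
  det (λ j i → g i * E j i) js is ≡ ∏ g is * det E js is
det-scale-cols g E [] [] _ = refl
det-scale-cols g E (j ∷ js) is len = begin
  det (λ j i → g i * E j i) (j ∷ js) is
    ≡⟨ det-row _ j js is ⟩
  ∑ (pick is) (λ (i , is′) → g i * E j i * det (λ j i → g i * E j i) js is′)
    ≡⟨ ∑-congOn (All.zipWith (λ {(_ , i , is′)} (e , l) → begin
         g i * E j i * det (λ j i → g i * E j i) js is′
           ≡⟨ cong (g i * E j i *_) (det-scale-cols g E js is′ (ℕ.suc-injective (trans len (sym l)))) ⟩
         g i * E j i * (∏ g is′ * det E js is′)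
           ≡⟨ lem (g i) (E j i) (∏ g is′) (det E js is′) ⟩
         g i * ∏ g is′ * (E j i * det E js is′)
           ≡⟨ cong (_* (E j i * det E js is′)) e ⟩
         ∏ g is * (E j i * det E js is′) ∎)
       (pick-∏ g is , pick-length is)) ⟩
  ∑ (pick is) (λ (i , is′) → ∏ g is * (E j i * det E js is′))
    ≡⟨ ∑-* (pick is) (∏ g is) _ ⟩
  ∏ g is * ∑ (pick is) (λ (i , is′) → E j i * det E js is′)
    ≡⟨ cong (∏ g is *_) (det-row E j js is) ⟨
  ∏ g is * det E (j ∷ js) is ∎
  where
  lem : ∀ x y z w → x * y * (z * w) ≡ x * z * (y * w)
  lem = solve-∀

-- Vandermonde determinants

self-negative⇒zero : ∀ {i} → i ≡ - i → i ≡ 0ℤ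
self-negative⇒zero {+ zero} _ = refl
self-negative⇒zero {+ suc _} ()
self-negative⇒zero { -[1+ _ ]} ()

det-row₂ : ∀ {J I : Set} (E : J → I → ℤ) j j′ js is → det E (j ∷ j′ ∷ js) is ≡
  ∑ (pick is) (λ (i , is′) → ∑ (pick is′) (λ (i′ , is″) → E j i * (E j′ i′ * det E js is″)))
det-row₂ E j j′ js is = trans (det-row E j (j′ ∷ js) is) (∑-cong (pick is) (λ (i , is′) →
  trans (cong (E j i *_) (det-row E j′ js is′)) (sym (∑-* (pick is′) (E j i) _))))

-- The extra contribution has proportional first two rows: it is symmetric in the two picked columns
-- and antisymmetric by `∑-pick₂-antisym`, hence equal to its own negative, and ℤ has no 2-torsion.
det-row-op : ∀ {J I : Set} (E F : J → I → ℤ) (μ : ℤ) j j′ js →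
  (∀ i → E j i ≡ F j i) → (∀ i → E j′ i ≡ F j′ i + μ * F j i) → (∀ is → det E js is ≡ det F js is) →
  ∀ is → det E (j ∷ j′ ∷ js) is ≡ det F (j ∷ j′ ∷ js) is
det-row-op E F μ j j′ js hj hj′ hjs is = begin
  det E (j ∷ j′ ∷ js) is
    ≡⟨ det-row₂ E j j′ js is ⟩
  ∑ (pick is) (λ (i , is′) → ∑ (pick is′) (λ (i′ , is″) → E j i * (E j′ i′ * det E js is″)))
    ≡⟨ ∑-cong (pick is) (λ (i , is′) → trans
         (∑-cong (pick is′) (λ (i′ , is″) → trans
           (cong₂ _*_ (hj i) (cong₂ _*_ (hj′ i′) (hjs is″)))
           (lem (F j i) (F j′ i′) μ (F j i′) (det F js is″))))
         (∑-+ (pick is′) _ _)) ⟩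
  ∑ (pick is) (λ (i , is′) → ∑ (pick is′) (λ (i′ , is″) → F j i * (F j′ i′ * det F js is″))
    + ∑ (pick is′) (λ (i′ , is″) → T i i′ is″))
    ≡⟨ ∑-+ (pick is) _ _ ⟩
  ∑ (pick is) (λ (i , is′) → ∑ (pick is′) (λ (i′ , is″) → F j i * (F j′ i′ * det F js is″)))
    + ∑ (pick is) (λ (i , is′) → ∑ (pick is′) (λ (i′ , is″) → T i i′ is″))
    ≡⟨ cong₂ _+_ (sym (det-row₂ F j j′ js is)) (self-negative⇒zero (trans (∑-pick₂-antisym is T) (cong -_
         (∑-cong (pick is) (λ (i , is′) → ∑-cong (pick is′) (λ (i′ , is″) → comm μ (F j i) (F j i′) (det F js is″))))))) ⟩
  det F (j ∷ j′ ∷ js) is + 0ℤ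
    ≡⟨ ℤ.+-identityʳ _ ⟩
  det F (j ∷ j′ ∷ js) is ∎
  where
  T = λ i i′ is″ → μ * (F j i * (F j i′ * det F js is″))
  lem : ∀ x y m z d → x * ((y + m * z) * d) ≡ x * (y * d) + m * (x * (z * d))
  lem = solve-∀
  comm : ∀ m x z d → m * (z * (x * d)) ≡ m * (x * (z * d))
  comm = solve-∀

-- General nodes let one evaluation serve both determinants of the proof: nodes 0, 0, 0, ... give
-- powers, nodes 0, 1, 2, ... give falling factorials.
newton : (ℕ → ℤ) → ℕ → ℤ → ℤ
newton c zero y = 1ℤ
newton c (suc e) y = (y - c 0) * newton (c ∘ suc) e y

newton-sucʳ : ∀ c e y → newton c (suc e) y ≡ newton c e y * (y - c e)
newton-sucʳ c zero y = ℤ.*-comm (y - c 0) 1ℤ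
newton-sucʳ c (suc e) y = trans (cong ((y - c 0) *_) (newton-sucʳ (c ∘ suc) e y)) (sym (ℤ.*-assoc (y - c 0) _ _))

vandermonde : List ℤ → ℤ
vandermonde [] = 1ℤ
vandermonde (h ∷ hs) = ∏ (_- h) hs * vandermonde hs

upTo-suc : ∀ k → upTo (suc k) ≡ 0 ∷ map suc (upTo k)
upTo-suc k = cong (0 ∷_) (sym (List.map-upTo suc k))

-- For distinct entries, dividing by the Vandermonde determinant gives the sum of the Lagrange basis
-- polynomials at γ. That sum is 1, so independence of γ is to be expected.
lagrange : ℤ → List ℤ → ℤ
lagrange γ hs = ∑ (pick hs) (λ (_ , hs′) → ∏ (_- γ) hs′ * vandermonde hs′)

-- The nodes are quantified inside because the induction hypothesis is applied to shifted nodes.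
NewtonDet : ℕ → Set
NewtonDet k = ∀ c hs → length hs ≡ k → det (newton c) (upTo k) hs ≡ vandermonde hs

-- Once the constant row is expanded, every entry left in the column of y has the factor y - c 0;
-- removing it leaves the Newton matrix of the shifted nodes.
det-newton-lagrange : ∀ k → NewtonDet k → ∀ c hs → length hs ≡ suc k → det (newton c) (upTo (suc k)) hs ≡ lagrange (c 0) hs
det-newton-lagrange k ih c hs len = begin
  det (newton c) (upTo (suc k)) hs
    ≡⟨ cong (λ us → det (newton c) us hs) (upTo-suc k) ⟩
  det (newton c) (0 ∷ map suc (upTo k)) hs
    ≡⟨ det-row (newton c) 0 (map suc (upTo k)) hs ⟩
  ∑ (pick hs) (λ (_ , hs′) → 1ℤ * det (newton c) (map suc (upTo k)) hs′)
    ≡⟨ ∑-congOn (All.map (λ {(_ , _ , hs′)} e → begin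
         1ℤ * det (newton c) (map suc (upTo k)) hs′
           ≡⟨ ℤ.*-identityˡ _ ⟩
         det (newton c) (map suc (upTo k)) hs′
           ≡⟨ det-map-rows (newton c) suc (upTo k) hs′ ⟩
         det (λ e y → (y - c 0) * newton (c ∘ suc) e y) (upTo k) hs′
           ≡⟨ det-scale-cols (_- c 0) (newton (c ∘ suc)) (upTo k) hs′
                (trans (List.length-upTo k) (ℕ.suc-injective (sym (trans e len)))) ⟩
         ∏ (_- c 0) hs′ * det (newton (c ∘ suc)) (upTo k) hs′
           ≡⟨ cong (∏ (_- c 0) hs′ *_) (ih (c ∘ suc) hs′ (ℕ.suc-injective (trans e len))) ⟩
         ∏ (_- c 0) hs′ * vandermonde hs′ ∎) (pick-length hs)) ⟩
  lagrange (c 0) hs ∎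

lagrange-const : ∀ k → NewtonDet (suc k) → ∀ γ δ hs → length hs ≡ suc (suc k) → lagrange γ hs ≡ lagrange δ hs
lagrange-const k ih γ δ hs len = begin
  lagrange γ hs
    ≡⟨ det-newton-lagrange (suc k) ih (nodes γ δ) hs len ⟨
  det (newton (nodes γ δ)) (upTo (suc (suc k))) hs
    ≡⟨ cong (λ us → det (newton (nodes γ δ)) us hs) split ⟩
  det (newton (nodes γ δ)) (0 ∷ 1 ∷ map (λ e → suc (suc e)) (upTo k)) hs
    ≡⟨ det-row-op (newton (nodes γ δ)) (newton (nodes δ γ)) (δ - γ) 0 1 (map (λ e → suc (suc e)) (upTo k))
         (λ _ → refl) (row₁ γ δ) rows hs ⟩
  det (newton (nodes δ γ)) (0 ∷ 1 ∷ map (λ e → suc (suc e)) (upTo k)) hs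
    ≡⟨ cong (λ us → det (newton (nodes δ γ)) us hs) split ⟨
  det (newton (nodes δ γ)) (upTo (suc (suc k))) hs
    ≡⟨ det-newton-lagrange (suc k) ih (nodes δ γ) hs len ⟩
  lagrange δ hs ∎
  where
  nodes : ℤ → ℤ → ℕ → ℤ
  nodes γ δ 0 = γ
  nodes γ δ 1 = δ
  -- Later nodes are arbitrary. From degree two on, a row contains both y - γ and y - δ, so
  -- exchanging the nodes affects only row 1.
  nodes γ δ (suc (suc _)) = 0ℤ
  split : upTo (suc (suc k)) ≡ 0 ∷ 1 ∷ map (λ e → suc (suc e)) (upTo k)
  split = trans (upTo-suc (suc k))
    (cong (0 ∷_) (trans (cong (map suc) (upTo-suc k)) (cong (1 ∷_) (sym (List.map-∘ (upTo k))))))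
  row₁ : ∀ γ δ y → (y - γ) * 1ℤ ≡ (y - δ) * 1ℤ + (δ - γ) * 1ℤ
  row₁ = solve-∀
  rows : ∀ is → det (newton (nodes γ δ)) (map (λ e → suc (suc e)) (upTo k)) is
              ≡ det (newton (nodes δ γ)) (map (λ e → suc (suc e)) (upTo k)) is
  rows is = trans (det-map-rows _ (λ e → suc (suc e)) (upTo k) is)
    (trans (det-cong (λ e y → comm γ δ y (newton (λ _ → 0ℤ) e y)) (upTo k) is)
      (sym (det-map-rows _ (λ e → suc (suc e)) (upTo k) is)))
    where
    comm : ∀ γ δ y z → (y - γ) * ((y - δ) * z) ≡ (y - δ) * ((y - γ) * z)
    comm = solve-∀

-- The expansion along the constant row depends on the nodes only through c 0; exchanging c 0 and c 1 is a
-- row operation, so c 0 is arbitrary, and taking it equal to a column entry leaves a single term.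
det-newton : ∀ k → NewtonDet k
det-newton zero c [] _ = refl
det-newton (suc zero) c (h ∷ []) _ = refl
det-newton (suc (suc k)) c (a ∷ hs) len = begin
  det (newton c) (upTo (suc (suc k))) (a ∷ hs)
    ≡⟨ det-newton-lagrange (suc k) (det-newton (suc k)) c (a ∷ hs) len ⟩
  lagrange (c 0) (a ∷ hs)
    ≡⟨ lagrange-const k (det-newton (suc k)) (c 0) a (a ∷ hs) len ⟩
  lagrange a (a ∷ hs)
    ≡⟨ ∑-pick a hs (λ (_ , hs′) → ∏ (_- a) hs′ * vandermonde hs′) ⟩
  vandermonde (a ∷ hs) - ∑ (pick hs) (λ (_ , hs′) → ∏ (_- a) (a ∷ hs′) * vandermonde (a ∷ hs′))
    ≡⟨ cong (_-_ (vandermonde (a ∷ hs))) (∑-zero (always (pick hs)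
         (λ (_ , hs′) → vanish a (∏ (_- a) hs′) (vandermonde (a ∷ hs′))))) ⟩
  vandermonde (a ∷ hs) - 0ℤ
    ≡⟨ ℤ.+-identityʳ _ ⟩
  vandermonde (a ∷ hs) ∎
  where
  vanish : ∀ a x y → (a - a) * x * y ≡ 0ℤ
  vanish = solve-∀

-- Divided differences and top coefficients

-- (∏ (g - β) - ∏ (g - x)) / (x - β), a polynomial in x.
quotient : List ℤ → ℤ → ℤ → ℤ
quotient [] β x = 0ℤ
quotient (g ∷ gs) β x = (g - β) * quotient gs β x + ∏ (_- x) gs

quotient-spec : ∀ gs β x → quotient gs β x * (x - β) ≡ ∏ (_- β) gs - ∏ (_- x) gs
quotient-spec [] β x = refl
quotient-spec (g ∷ gs) β x = begin
  ((g - β) * quotient gs β x + ∏ (_- x) gs) * (x - β)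
    ≡⟨ lem₁ g β x (quotient gs β x) (∏ (_- x) gs) ⟩
  (g - β) * (quotient gs β x * (x - β)) + ∏ (_- x) gs * (x - β)
    ≡⟨ cong (λ z → (g - β) * z + ∏ (_- x) gs * (x - β)) (quotient-spec gs β x) ⟩
  (g - β) * (∏ (_- β) gs - ∏ (_- x) gs) + ∏ (_- x) gs * (x - β)
    ≡⟨ lem₂ g β x (∏ (_- β) gs) (∏ (_- x) gs) ⟩
  (g - β) * ∏ (_- β) gs - (g - x) * ∏ (_- x) gs ∎
  where
  lem₁ : ∀ g β x q P → ((g - β) * q + P) * (x - β) ≡ (g - β) * (q * (x - β)) + P * (x - β)
  lem₁ = solve-∀
  lem₂ : ∀ g β x P Q → (g - β) * (P - Q) + Q * (x - β) ≡ (g - β) * P - (g - x) * Q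
  lem₂ = solve-∀

module DividedDifference {X : Set} (v : X → ℤ) where

  -- An integer multiple of the divided difference at b ∷ bs, built from
  -- f[β, bs] = ((f - f β) / (· - β))[bs] with the denominators cleared.
  divDiff : X → List X → Comb X
  divDiff b [] = (1ℤ , b) ∷ []
  divDiff β (b ∷ bs) = bind (divDiff b bs)
    (λ x → (quotient (map v (b ∷ bs)) (v β) (v x) , x) ∷ (- quotient (map v (b ∷ bs)) (v β) (v x) , β) ∷ [])

  -- The support is described by a vanishing product because this is the term of `quotient-spec`
  -- that must disappear: on the support, the quotient times v x - v β becomes constant.
  divDiff-support : ∀ b bs → On (λ x → ∏ (_- v x) (map v (b ∷ bs)) ≡ 0ℤ) (divDiff b bs)
  divDiff-support b [] = lem (v b) 1ℤ ∷ []
    where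
    lem : ∀ x y → (x - x) * y ≡ 0ℤ
    lem = solve-∀
  divDiff-support β (b ∷ bs) = On-bind {l = divDiff b bs}
    (λ {x} e → trans (cong ((v β - v x) *_) e) (ℤ.*-zeroʳ (v β - v x)) ∷ lem (v β) _ ∷ [])
    (divDiff-support b bs)
    where
    lem : ∀ x y → (x - x) * y ≡ 0ℤ
    lem = solve-∀

  moment : X → List X → ℕ → ℤ
  moment b bs r = ∑ (divDiff b bs) (λ x → v x ^ r)

  moment-∷-zero : ∀ β b bs → moment β (b ∷ bs) 0 ≡ 0ℤ
  moment-∷-zero β b bs = trans (∑-bind (divDiff b bs) _ _) (∑-zero (always (divDiff b bs) (λ x → lem (quotient (map v (b ∷ bs)) (v β) (v x)))))
    where
    lem : ∀ q → q * 1ℤ + (- q * 1ℤ + 0ℤ) ≡ 0ℤ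
    lem = solve-∀

  -- Use x · x^r - β · β^r = (x - β) x^r + β (x^r - β^r); the quotient turns x - β into a constant
  -- on the support.
  moment-∷-suc : ∀ β b bs r →
    moment β (b ∷ bs) (suc r) ≡ ∏ (_- v β) (map v (b ∷ bs)) * moment b bs r + v β * moment β (b ∷ bs) r
  moment-∷-suc β b bs r = begin
    moment β (b ∷ bs) (suc r)
      ≡⟨ ∑-bind (divDiff b bs) _ _ ⟩
    ∑ (divDiff b bs) (λ x → q x * v x ^ suc r + (- q x * v β ^ suc r + 0ℤ))
      ≡⟨ ∑-congOn (All.map (λ {(_ , x)} e → begin
           q x * v x ^ suc r + (- q x * v β ^ suc r + 0ℤ)
             ≡⟨ lem₁ (q x) (v x) (v β) (v x ^ r) (v β ^ r) ⟩
           q x * (v x - v β) * v x ^ r + v β * (q x * v x ^ r + (- q x * v β ^ r + 0ℤ))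
             ≡⟨ cong (λ z → z * v x ^ r + v β * (q x * v x ^ r + (- q x * v β ^ r + 0ℤ)))
                  (trans (quotient-spec (map v (b ∷ bs)) (v β) (v x))
                    (trans (cong (_-_ D) e) (ℤ.+-identityʳ D))) ⟩
           D * v x ^ r + v β * (q x * v x ^ r + (- q x * v β ^ r + 0ℤ)) ∎)
         (divDiff-support b bs)) ⟩
    ∑ (divDiff b bs) (λ x → D * v x ^ r + v β * (q x * v x ^ r + (- q x * v β ^ r + 0ℤ)))
      ≡⟨ ∑-+ (divDiff b bs) _ _ ⟩
    ∑ (divDiff b bs) (λ x → D * v x ^ r)
      + ∑ (divDiff b bs) (λ x → v β * (q x * v x ^ r + (- q x * v β ^ r + 0ℤ)))
      ≡⟨ cong₂ _+_ (∑-* (divDiff b bs) D _)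
           (trans (∑-* (divDiff b bs) (v β) _) (cong (v β *_) (sym (∑-bind (divDiff b bs) _ _)))) ⟩
    D * moment b bs r + v β * moment β (b ∷ bs) r ∎
    where
    q : X → ℤ
    q x = quotient (map v (b ∷ bs)) (v β) (v x)
    D : ℤ
    D = ∏ (_- v β) (map v (b ∷ bs))
    lem₁ : ∀ q x β X Y → q * (x * X) + (- q * (β * Y) + 0ℤ) ≡ q * (x - β) * X + β * (q * X + (- q * Y + 0ℤ))
    lem₁ = solve-∀

  moment-low : ∀ b bs r → r < length bs → moment b bs r ≡ 0ℤ
  moment-low β (b ∷ bs) zero _ = moment-∷-zero β b bs
  moment-low β (b ∷ bs) (suc r) (s≤s r<) = begin
    moment β (b ∷ bs) (suc r)
      ≡⟨ moment-∷-suc β b bs r ⟩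
    D * moment b bs r + v β * moment β (b ∷ bs) r
      ≡⟨ cong₂ (λ x y → D * x + v β * y) (moment-low b bs r r<)
           (moment-low β (b ∷ bs) r (ℕ.m≤n⇒m≤1+n r<)) ⟩
    D * 0ℤ + v β * 0ℤ
      ≡⟨ lem D (v β) ⟩
    0ℤ ∎
    where
    D : ℤ
    D = ∏ (_- v β) (map v (b ∷ bs))
    lem : ∀ x y → x * 0ℤ + y * 0ℤ ≡ 0ℤ
    lem = solve-∀

  -- The true divided difference has top moment 1, so this value is the factor by which its
  -- denominators were cleared.
  moment-top : ∀ b bs → moment b bs (length bs) ≡ vandermonde (map v (b ∷ bs))
  moment-top b [] = refl
  moment-top β (b ∷ bs) = begin
    moment β (b ∷ bs) (suc (length bs))
      ≡⟨ moment-∷-suc β b bs (length bs) ⟩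
    D * moment b bs (length bs) + v β * moment β (b ∷ bs) (length bs)
      ≡⟨ cong₂ (λ x y → D * x + v β * y) (moment-top b bs) (moment-low β (b ∷ bs) (length bs) ℕ.≤-refl) ⟩
    D * vandermonde (map v (b ∷ bs)) + v β * 0ℤ
      ≡⟨ lem (D * vandermonde (map v (b ∷ bs))) (v β) ⟩
    D * vandermonde (map v (b ∷ bs)) ∎
    where
    D : ℤ
    D = ∏ (_- v β) (map v (b ∷ bs))
    lem : ∀ x y → x + y * 0ℤ ≡ x
    lem = solve-∀

-- This is d! / (d - e)!, and 0 for e > d: the reciprocal factorials of a multinomial coefficient,
-- scaled by d! to stay integral.
falling : ℕ → ℕ → ℤ
falling d e = newton +_ e (+ d)

falling-suc : ∀ d e → falling d (suc e) ≡ falling d e * (+ d - + e)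
falling-suc d e = newton-sucʳ +_ e (+ d)

falling-vanishes : ∀ {d e} → d < e → falling d e ≡ 0ℤ
falling-vanishes {d} {suc e} (s≤s d≤e) with ℕ.m≤n⇒m<n∨m≡n d≤e
... | inj₁ d<e = trans (falling-suc d e) (cong (_* (+ d - + e)) (falling-vanishes d<e))
... | inj₂ refl = trans (falling-suc d e) (trans (cong (falling d d *_) (ℤ.+-inverseʳ (+ d))) (ℤ.*-zeroʳ (falling d d)))

bumps : List ℕ → Comb (List ℕ)
bumps [] = []
bumps (e ∷ α) = (1ℤ , suc e ∷ α) ∷ weigh 1ℤ (e ∷_) (bumps α)

∑-bumps : ∀ e α (f : List ℕ → ℤ) → ∑ (bumps (e ∷ α)) f ≡ f (suc e ∷ α) + ∑ (bumps α) (λ β → f (e ∷ β))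
∑-bumps e α f = cong₂ _+_ (ℤ.*-identityˡ (f (suc e ∷ α))) (trans (∑-weigh 1ℤ (e ∷_) (bumps α) f) (ℤ.*-identityˡ _))

bumps-length : ∀ α → On (λ β → length β ≡ length α) (bumps α)
bumps-length [] = []
bumps-length (e ∷ α) = refl ∷ On-weigh 1ℤ (e ∷_) (cong suc) (bumps-length α)

bumps-sum : ∀ α → On (λ β → sum β ≡ suc (sum α)) (bumps α)
bumps-sum [] = []
bumps-sum (e ∷ α) = refl ∷ On-weigh 1ℤ (e ∷_)
  (λ h → trans (cong (e ℕ.+_) h) (ℕ.+-suc e (sum α))) (bumps-sum α)

-- Raising an exponent e multiplies its factor by d - e, and these numbers add up to k d - `sum α`,
-- where k is the length of α.
bumps-falling : ∀ d α →
  ∑ (bumps α) (∏ (falling d)) ≡ (+ (length α ℕ.* d) - + sum α) * ∏ (falling d) α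
bumps-falling d [] = refl
bumps-falling d (e ∷ α) = begin
  ∑ (bumps (e ∷ α)) (∏ (falling d))
    ≡⟨ ∑-bumps e α (∏ (falling d)) ⟩
  falling d (suc e) * F + ∑ (bumps α) (λ β → falling d e * ∏ (falling d) β)
    ≡⟨ cong₂ _+_ (cong (_* F) (falling-suc d e))
         (trans (∑-* (bumps α) (falling d e) _) (cong (falling d e *_) (bumps-falling d α))) ⟩
  falling d e * (+ d - + e) * F + falling d e * ((+ (length α ℕ.* d) - + sum α) * F)
    ≡⟨ lem (falling d e) F (+ d) (+ e) (+ (length α ℕ.* d)) (+ sum α) ⟩
  (+ (d ℕ.+ length α ℕ.* d) - + (e ℕ.+ sum α)) * (falling d e * F) ∎
  where
  F : ℤ
  F = ∏ (falling d) α
  lem : ∀ f F d e L S → f * (d - e) * F + f * ((L - S) * F) ≡ ((d + L) - (e + S)) * (f * F)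
  lem = solve-∀

total : ∀ {X : Set} → (X → ℤ) → List X → ℤ
total v [] = 0ℤ
total v (x ∷ xs) = v x + total v xs

monomial : ∀ {X : Set} → (X → ℤ) → List ℕ → List X → ℤ
monomial v [] [] = 1ℤ
monomial v (e ∷ α) (x ∷ xs) = v x ^ e * monomial v α xs
-- The value 0 for unequal lengths lets `total*monomial` hold without a length hypothesis.
monomial v _ _ = 0ℤ

total*monomial : ∀ {X : Set} (v : X → ℤ) α xs →
  total v xs * monomial v α xs ≡ ∑ (bumps α) (λ β → monomial v β xs)
total*monomial v [] [] = refl
total*monomial v [] (x ∷ xs) = ℤ.*-zeroʳ (v x + total v xs)
total*monomial v (e ∷ α) [] = sym (trans (∑-bumps e α (λ β → monomial v β [])) (trans (ℤ.+-identityˡ _)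
  (∑-zero (always (bumps α) (λ _ → refl)))))
total*monomial v (e ∷ α) (x ∷ xs) = begin
  (v x + total v xs) * (v x ^ e * monomial v α xs)
    ≡⟨ lem (v x) (total v xs) (v x ^ e) (monomial v α xs) ⟩
  v x ^ suc e * monomial v α xs + v x ^ e * (total v xs * monomial v α xs)
    ≡⟨ cong (_+_ (v x ^ suc e * monomial v α xs))
         (trans (cong (v x ^ e *_) (total*monomial v α xs)) (sym (∑-* (bumps α) (v x ^ e) _))) ⟩
  v x ^ suc e * monomial v α xs + ∑ (bumps α) (λ β → v x ^ e * monomial v β xs)
    ≡⟨ ∑-bumps e α (λ β → monomial v β (x ∷ xs)) ⟨
  ∑ (bumps (e ∷ α)) (λ β → monomial v β (x ∷ xs)) ∎
  where
  lem : ∀ x t p m → (x + t) * (p * m) ≡ x * p * m + p * (t * m)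
  lem = solve-∀

-- The tensor power of a functional, acting on functions of k variables.
power : ∀ {X : Set} → Comb X → ℕ → Comb (List X)
power l zero = (1ℤ , []) ∷ []
power l (suc k) = bind l (λ x → weigh 1ℤ (x ∷_) (power l k))

power-length : ∀ {X : Set} (l : Comb X) k → On (λ xs → length xs ≡ k) (power l k)
power-length l zero = refl ∷ []
-- The predicate `0 ≡ 0` on the entries of `l` is a dummy: only the number of entries in a tuple
-- matters.
power-length l (suc k) = On-bind {l = l} (λ {x} _ → On-weigh 1ℤ (x ∷_) (cong suc) (power-length l k)) (always l (λ _ → refl {x = 0}))

module TopCoefficient {X : Set} (v : X → ℤ) (l : Comb X) (d : ℕ) (top : ℤ)
  (low : ∀ r → r < d → ∑ l (λ x → v x ^ r) ≡ 0ℤ) (high : ∑ l (λ x → v x ^ d) ≡ top) where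

  momentSum : ℕ → ℕ → List ℕ → ℤ
  momentSum k s α = ∑ (power l k) (λ xs → total v xs ^ s * monomial v α xs)

  μ : ℕ → ℤ
  μ r = ∑ l (λ x → v x ^ r)

  momentSum-zero : ∀ α → momentSum (length α) 0 α ≡ ∏ μ α
  momentSum-zero [] = refl
  momentSum-zero (e ∷ α) = begin
    momentSum (suc (length α)) 0 (e ∷ α)
      ≡⟨ ∑-bind l _ (λ xs → 1ℤ * monomial v (e ∷ α) xs) ⟩
    ∑ l (λ x → ∑ (weigh 1ℤ (x ∷_) (power l (length α))) (λ xs → 1ℤ * monomial v (e ∷ α) xs))
      ≡⟨ ∑-cong l (λ x → begin
           ∑ (weigh 1ℤ (x ∷_) (power l (length α))) (λ xs → 1ℤ * monomial v (e ∷ α) xs)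
             ≡⟨ trans (∑-weigh 1ℤ (x ∷_) (power l (length α)) _) (ℤ.*-identityˡ _) ⟩
           ∑ (power l (length α)) (λ xs → 1ℤ * (v x ^ e * monomial v α xs))
             ≡⟨ trans (∑-cong (power l (length α)) (λ xs → lem (v x ^ e) (monomial v α xs)))
                  (∑-* (power l (length α)) (v x ^ e) _) ⟩
           v x ^ e * momentSum (length α) 0 α
             ≡⟨ trans (cong (v x ^ e *_) (momentSum-zero α)) (ℤ.*-comm (v x ^ e) (∏ μ α)) ⟩
           ∏ μ α * v x ^ e ∎) ⟩
    ∑ l (λ x → ∏ μ α * v x ^ e)
      ≡⟨ trans (∑-* l (∏ μ α) _) (ℤ.*-comm (∏ μ α) (μ e)) ⟩
    μ e * ∏ μ α ∎
    where
    lem : ∀ p m → 1ℤ * (p * m) ≡ p * (1ℤ * m)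
    lem = solve-∀

  momentSum-suc : ∀ k s α → momentSum k (suc s) α ≡ ∑ (bumps α) (momentSum k s)
  momentSum-suc k s α = begin
    ∑ (power l k) (λ xs → total v xs ^ suc s * monomial v α xs)
      ≡⟨ ∑-cong (power l k) (λ xs → trans (lem (total v xs) (total v xs ^ s) (monomial v α xs))
           (trans (cong (total v xs ^ s *_) (total*monomial v α xs)) (sym (∑-* (bumps α) (total v xs ^ s) _)))) ⟩
    ∑ (power l k) (λ xs → ∑ (bumps α) (λ β → total v xs ^ s * monomial v β xs))
      ≡⟨ ∑-swap (power l k) (bumps α) _ ⟩
    ∑ (bumps α) (momentSum k s) ∎
    where
    lem : ∀ t T m → t * T * m ≡ T * (t * m)
    lem = solve-∀

  -- Pigeonhole: some exponent lies below d, and its moment vanishes.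
  ∏μ-low : ∀ α → sum α < length α ℕ.* d → ∏ μ α ≡ 0ℤ
  ∏μ-low (e ∷ α) h with ℕ.<-≤-connex e d
  ... | inj₁ e<d = cong (_* ∏ μ α) (low e e<d)
  ... | inj₂ d≤e = trans (cong (μ e *_)
    (∏μ-low α (ℕ.+-cancelˡ-< d _ _ (ℕ.≤-<-trans (ℕ.+-monoˡ-≤ (sum α) d≤e) h)))) (ℤ.*-zeroʳ (μ e))

  ∏falling-high : ∀ α → length α ℕ.* d < sum α → ∏ (falling d) α ≡ 0ℤ
  ∏falling-high (e ∷ α) h with ℕ.<-≤-connex d e
  ... | inj₁ d<e = cong (_* ∏ (falling d) α) (falling-vanishes d<e)
  ... | inj₂ e≤d = trans (cong (falling d e *_)
    (∏falling-high α (ℕ.+-cancelˡ-< d _ _ (ℕ.<-≤-trans h (ℕ.+-monoˡ-≤ (sum α) e≤d))))) (ℤ.*-zeroʳ (falling d e))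

  -- At this total degree, exponents not all equal to d lie on both sides of d. A small one kills
  -- the product of moments, a large one the product of falling factorials; if all equal d, both
  -- sides agree factor by factor.
  ∏μ-exact : ∀ α → sum α ≡ length α ℕ.* d →
    ∏ μ α * falling d d ^ length α ≡ top ^ length α * ∏ (falling d) α
  ∏μ-exact [] h = refl
  ∏μ-exact (e ∷ α) h with ℕ.<-cmp e d
  ... | tri< e<d _ _ = begin
    μ e * ∏ μ α * (F * F ^ length α)
      ≡⟨ cong (λ z → z * ∏ μ α * (F * F ^ length α)) (low e e<d) ⟩
    0ℤ
      ≡⟨ lem (top ^ suc (length α)) (falling d e) ⟨
    top ^ suc (length α) * (falling d e * 0ℤ)
      ≡⟨ cong (λ z → top ^ suc (length α) * (falling d e * z)) (∏falling-high α
           (ℕ.+-cancelˡ-< d _ _ (ℕ.<-≤-trans (ℕ.≤-reflexive (cong suc (sym h))) (ℕ.+-monoˡ-≤ (sum α) e<d)))) ⟨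
    top ^ suc (length α) * (falling d e * ∏ (falling d) α) ∎
    where
    F : ℤ
    F = falling d d
    lem : ∀ x y → x * (y * 0ℤ) ≡ 0ℤ
    lem = solve-∀
  ... | tri≈ _ refl _ = begin
    μ d * ∏ μ α * (F * F ^ length α)
      ≡⟨ lem (μ d) (∏ μ α) F (F ^ length α) ⟩
    μ d * F * (∏ μ α * F ^ length α)
      ≡⟨ cong₂ (λ x y → x * F * y) high (∏μ-exact α (ℕ.+-cancelˡ-≡ d _ _ h)) ⟩
    top * F * (top ^ length α * ∏ (falling d) α)
      ≡⟨ lem top F (top ^ length α) (∏ (falling d) α) ⟩
    top * top ^ length α * (F * ∏ (falling d) α) ∎
    where
    F : ℤ
    F = falling d d
    lem : ∀ m P F G → m * P * (F * G) ≡ m * F * (P * G)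
    lem = solve-∀
  ... | tri> _ _ d<e = begin
    μ e * ∏ μ α * (F * F ^ length α)
      ≡⟨ cong (λ z → μ e * z * (F * F ^ length α)) (∏μ-low α
           (ℕ.+-cancelˡ-< d _ _ (ℕ.≤-trans (ℕ.+-monoˡ-≤ (sum α) d<e) (ℕ.≤-reflexive h)))) ⟩
    μ e * 0ℤ * (F * F ^ length α)
      ≡⟨ lem (μ e) (F * F ^ length α) (top ^ suc (length α)) (∏ (falling d) α) ⟩
    top ^ suc (length α) * (0ℤ * ∏ (falling d) α)
      ≡⟨ cong (λ z → top ^ suc (length α) * (z * ∏ (falling d) α)) (falling-vanishes d<e) ⟨
    top ^ suc (length α) * (falling d e * ∏ (falling d) α) ∎
    where
    F : ℤ
    F = falling d d
    lem : ∀ x y z w → x * 0ℤ * y ≡ z * (0ℤ * w)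
    lem = solve-∀

  momentSum-low : ∀ s α → s ℕ.+ sum α < length α ℕ.* d → momentSum (length α) s α ≡ 0ℤ
  momentSum-low zero α h = trans (momentSum-zero α) (∏μ-low α h)
  momentSum-low (suc s) α h = trans (momentSum-suc (length α) s α) (∑-zero (All.zipWith (λ {(_ , β)} (len , sm) →
    subst (λ k → momentSum k s β ≡ 0ℤ) len (momentSum-low s β (subst₂ _<_
      (trans (sym (ℕ.+-suc s (sum α))) (cong (s ℕ.+_) (sym sm))) (cong (ℕ._* d) (sym len)) h)))
    (bumps-length α , bumps-sum α)))

  -- The multinomial coefficient s! / ∏ (d - αᵢ)!, times topᵏ, with denominators cleared by d!ᵏ. In
  -- the induction, the factor k d - `sum α` from `bumps-falling` equals `suc s` and builds up the
  -- factorial.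
  momentSum-exact : ∀ s α → s ℕ.+ sum α ≡ length α ℕ.* d →
    momentSum (length α) s α * falling d d ^ length α ≡ + (s !) * (top ^ length α * ∏ (falling d) α)
  momentSum-exact zero α h = trans (cong (_* falling d d ^ length α) (momentSum-zero α))
    (trans (∏μ-exact α h) (sym (ℤ.*-identityˡ _)))
  momentSum-exact (suc s) α h = begin
    momentSum (length α) (suc s) α * F
      ≡⟨ trans (cong (_* F) (momentSum-suc (length α) s α)) (trans (ℤ.*-comm _ F) (sym (∑-* (bumps α) F _))) ⟩
    ∑ (bumps α) (λ β → F * momentSum (length α) s β)
      ≡⟨ ∑-congOn (All.zipWith (λ {(_ , β)} (len , sm) → begin
           F * momentSum (length α) s β
             ≡⟨ ℤ.*-comm F _ ⟩
           momentSum (length α) s β * F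
             ≡⟨ subst (λ k → momentSum k s β * falling d d ^ k ≡ + (s !) * (top ^ k * ∏ (falling d) β)) len
                  (momentSum-exact s β (trans (cong (s ℕ.+_) sm)
                    (trans (ℕ.+-suc s (sum α)) (trans h (cong (ℕ._* d) (sym len)))))) ⟩
           + (s !) * (top ^ length α * ∏ (falling d) β)
             ≡⟨ ℤ.*-assoc (+ (s !)) (top ^ length α) _ ⟨
           + (s !) * top ^ length α * ∏ (falling d) β ∎)
         (bumps-length α , bumps-sum α)) ⟩
    ∑ (bumps α) (λ β → + (s !) * top ^ length α * ∏ (falling d) β)
      ≡⟨ ∑-* (bumps α) (+ (s !) * top ^ length α) (∏ (falling d)) ⟩
    + (s !) * top ^ length α * ∑ (bumps α) (∏ (falling d))
      ≡⟨ cong (+ (s !) * top ^ length α *_) (bumps-falling d α) ⟩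
    + (s !) * top ^ length α * ((+ (length α ℕ.* d) - + sum α) * ∏ (falling d) α)
      ≡⟨ cong (λ z → + (s !) * top ^ length α * (z * ∏ (falling d) α))
           (trans (cong (λ z → + z - + sum α) (sym h)) (lem₁ (+ suc s) (+ sum α))) ⟩
    + (s !) * top ^ length α * (+ suc s * ∏ (falling d) α)
      ≡⟨ lem₂ (+ (s !)) (top ^ length α) (+ suc s) (∏ (falling d) α) ⟩
    + suc s * + (s !) * (top ^ length α * ∏ (falling d) α)
      ≡⟨ cong (_* (top ^ length α * ∏ (falling d) α)) (ℤ.pos-* (suc s) (s !)) ⟨
    + (suc s !) * (top ^ length α * ∏ (falling d) α) ∎
    where
    F : ℤ
    F = falling d d ^ length α
    lem₁ : ∀ x y → x + y - y ≡ x
    lem₁ = solve-∀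
    lem₂ : ∀ a b c e → a * b * (c * e) ≡ c * a * (b * e)
    lem₂ = solve-∀

-- Coefficient of the twisted product

-- Iterates `On-pick`, since `alt` builds each word by repeatedly moving an entry to the front.
alt-invariant : ∀ {I S : Set} (h : List I → S) (c : I → S → S) → (∀ i is → h (i ∷ is) ≡ c i (h is)) →
  (∀ i j s → c i (c j s) ≡ c j (c i s)) → ∀ n is → On (λ w → h w ≡ h is) (alt n is)
alt-invariant h c cons comm zero [] = refl ∷ []
alt-invariant h c cons comm zero (_ ∷ _) = []
alt-invariant h c cons comm (suc n) is = On-bind {l = pick is}
  (λ {(i , is′)} e → On-weigh 1ℤ (i ∷_)
    (λ {w} e′ → trans (cons i w) (trans (cong (c i) e′) e))
    (alt-invariant h c cons comm n is′))
  (On-pick h c cons comm is)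

alt-length : ∀ {I : Set} n (is : List I) → On (λ w → length w ≡ length is) (alt n is)
alt-length = alt-invariant length (λ _ → suc) (λ _ _ → refl) (λ _ _ _ → refl)

alt-sum : ∀ n is → On (λ w → sum w ≡ sum is) (alt n is)
alt-sum = alt-invariant sum ℕ._+_ (λ _ _ → refl) (λ i j s →
  trans (sym (ℕ.+-assoc i j s)) (trans (cong (ℕ._+ s) (ℕ.+-comm i j)) (ℕ.+-assoc j i s)))

-- With 2j for e, the first part depends only on the column index j and can leave the determinant;
-- the second is a Newton polynomial at d - 2j.
falling-+ : ∀ d e r → falling d (e ℕ.+ r) ≡ falling d e * newton +_ r (+ d - + e)
falling-+ d e zero = trans (cong (falling d) (ℕ.+-identityʳ e)) (sym (ℤ.*-identityʳ _))
falling-+ d e (suc r) = begin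
  falling d (e ℕ.+ suc r)
    ≡⟨ cong (falling d) (ℕ.+-suc e r) ⟩
  falling d (suc (e ℕ.+ r))
    ≡⟨ falling-suc d (e ℕ.+ r) ⟩
  falling d (e ℕ.+ r) * (+ d - (+ e + + r))
    ≡⟨ cong (_* (+ d - (+ e + + r))) (falling-+ d e r) ⟩
  falling d e * newton +_ r (+ d - + e) * (+ d - (+ e + + r))
    ≡⟨ lem (falling d e) (newton +_ r (+ d - + e)) (+ d) (+ e) (+ r) ⟩
  falling d e * (newton +_ r (+ d - + e) * (+ d - + e - + r))
    ≡⟨ cong (falling d e *_) (newton-sucʳ +_ r (+ d - + e)) ⟨
  falling d e * newton +_ (suc r) (+ d - + e) ∎
  where
  lem : ∀ f n d e r → f * n * (d - (e + r)) ≡ f * (n * (d - e - r))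
  lem = solve-∀

evenPowers : ∀ {X : Set} → (X → ℤ) → X → ℕ → ℤ
evenPowers v x j = v x ^ (2 ℕ.* j)

det-evenPowers : ∀ {X : Set} (v : X → ℤ) xs →
  det (evenPowers v) xs (upTo (length xs)) ≡ vandermonde (map (λ x → v x * v x) xs)
det-evenPowers v xs = begin
  det (evenPowers v) xs js
    ≡⟨ det-transpose (evenPowers v) xs js ⟩
  det (λ j x → v x ^ (2 ℕ.* j)) js xs
    ≡⟨ det-cong (λ j x → trans (sym (ℤ.^-*-assoc (v x) 2 j))
         (trans (cong (λ y → (v x * y) ^ j) (ℤ.*-identityʳ (v x))) (sym (newton-monomial j (v x * v x))))) js xs ⟩
  det (λ j x → newton (λ _ → 0ℤ) j (v x * v x)) js xs
    ≡⟨ det-map-cols (newton (λ _ → 0ℤ)) (λ x → v x * v x) js xs ⟨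
  det (newton (λ _ → 0ℤ)) js (map (λ x → v x * v x) xs)
    ≡⟨ det-newton (length xs) (λ _ → 0ℤ) (map (λ x → v x * v x) xs) (List.length-map _ xs) ⟩
  vandermonde (map (λ x → v x * v x) xs) ∎
  where
  js : List ℕ
  js = upTo (length xs)
  newton-monomial : ∀ e y → newton (λ _ → 0ℤ) e y ≡ y ^ e
  newton-monomial zero y = refl
  newton-monomial (suc e) y = cong₂ _*_ (ℤ.+-identityʳ y) (newton-monomial e y)

-- Exponents of ∏ xᵢⁱ multiplied by the Leibniz term of the permutation w in the determinant of even
-- powers.
twist : List ℕ → List ℕ → List ℕ
twist = zipWith (λ e j → 2 ℕ.* j ℕ.+ e)

length-twist : ∀ es w → length w ≡ length es → length (twist es w) ≡ length es
length-twist [] [] _ = refl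
length-twist (e ∷ es) (j ∷ w) h = cong suc (length-twist es w (ℕ.suc-injective h))

sum-twist : ∀ es w → length w ≡ length es → sum (twist es w) ≡ 2 ℕ.* sum w ℕ.+ sum es
sum-twist [] [] _ = refl
sum-twist (e ∷ es) (j ∷ w) h =
  trans (cong (2 ℕ.* j ℕ.+ e ℕ.+_) (sum-twist es w (ℕ.suc-injective h))) (lem j e (sum w) (sum es))
  where
  lem : ∀ j e w s → 2 ℕ.* j ℕ.+ e ℕ.+ (2 ℕ.* w ℕ.+ s) ≡ 2 ℕ.* (j ℕ.+ w) ℕ.+ (e ℕ.+ s)
  lem = ℕ-Solver.solve-∀

monomial-twist : ∀ {X : Set} (v : X → ℤ) es w xs → length w ≡ length es → length xs ≡ length es →
  monomial v es xs * entries (evenPowers v) xs w ≡ monomial v (twist es w) xs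
monomial-twist v [] [] [] _ _ = refl
monomial-twist v (e ∷ es) (j ∷ w) (x ∷ xs) h h′ = begin
  v x ^ e * monomial v es xs * (v x ^ (2 ℕ.* j) * entries (evenPowers v) xs w)
    ≡⟨ lem (v x ^ e) (monomial v es xs) (v x ^ (2 ℕ.* j)) (entries (evenPowers v) xs w) ⟩
  v x ^ (2 ℕ.* j) * v x ^ e * (monomial v es xs * entries (evenPowers v) xs w)
    ≡⟨ cong₂ _*_ (sym (ℤ.^-distribˡ-+-* (v x) (2 ℕ.* j) e))
         (monomial-twist v es w xs (ℕ.suc-injective h) (ℕ.suc-injective h′)) ⟩
  v x ^ (2 ℕ.* j ℕ.+ e) * monomial v (twist es w) xs ∎
  where
  lem : ∀ a b c d → a * b * (c * d) ≡ c * a * (b * d)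
  lem = solve-∀

∏-falling-twist : ∀ d es w → length w ≡ length es → ∏ (falling d) (twist es w) ≡
  entries (λ e j → falling d (2 ℕ.* j) * newton +_ e (+ d - + (2 ℕ.* j))) es w
∏-falling-twist d [] [] _ = refl
∏-falling-twist d (e ∷ es) (j ∷ w) h =
  cong₂ _*_ (falling-+ d (2 ℕ.* j) e) (∏-falling-twist d es w (ℕ.suc-injective h))

-- Only the leading term of ∏ (t - c) is seen by a functional that kills the lower powers of t.
∑-locator : ∀ {A : Set} (l : Comb A) (t g : A → ℤ) m →
  (∀ r → r < m → ∑ l (λ a → t a ^ r * g a) ≡ 0ℤ) → ∀ cs s → length cs ℕ.+ s ≤ m →
  ∑ l (λ a → ∏ (_-_ (t a)) cs * (t a ^ s * g a)) ≡ ∑ l (λ a → t a ^ (length cs ℕ.+ s) * g a)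
∑-locator l t g m h [] s _ = ∑-cong l (λ a → ℤ.*-identityˡ _)
∑-locator l t g m h (c ∷ cs) s le = begin
  ∑ l (λ a → (t a - c) * ∏ (_-_ (t a)) cs * (t a ^ s * g a))
    ≡⟨ ∑-cong l (λ a → lem (t a) c (∏ (_-_ (t a)) cs) (t a ^ s) (g a)) ⟩
  ∑ l (λ a → ∏ (_-_ (t a)) cs * (t a ^ suc s * g a) - c * (∏ (_-_ (t a)) cs * (t a ^ s * g a)))
    ≡⟨ ∑-- l _ _ ⟩
  ∑ l (λ a → ∏ (_-_ (t a)) cs * (t a ^ suc s * g a)) - ∑ l (λ a → c * (∏ (_-_ (t a)) cs * (t a ^ s * g a)))
    ≡⟨ cong₂ _-_
         (trans (∑-locator l t g m h cs (suc s) (subst (_≤ m) (sym (ℕ.+-suc (length cs) s)) le))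
           (cong (λ r → ∑ l (λ a → t a ^ r * g a)) (ℕ.+-suc (length cs) s)))
         (trans (∑-* l c _) (trans (cong (c *_)
           (trans (∑-locator l t g m h cs s (ℕ.<⇒≤ le)) (h (length cs ℕ.+ s) le))) (ℤ.*-zeroʳ c))) ⟩
  ∑ l (λ a → t a ^ suc (length cs ℕ.+ s) * g a) - 0ℤ
    ≡⟨ ℤ.+-identityʳ _ ⟩
  ∑ l (λ a → t a ^ suc (length cs ℕ.+ s) * g a) ∎
  where
  lem : ∀ t c P T g → (t - c) * P * (T * g) ≡ P * (t * T * g) - c * (P * (T * g))
  lem = solve-∀

module TwistedCoefficient {X : Set} (v : X → ℤ) (l : Comb X) (d : ℕ) (top : ℤ)
  (low : ∀ r → r < d → ∑ l (λ x → v x ^ r) ≡ 0ℤ) (high : ∑ l (λ x → v x ^ d) ≡ top) (k : ℕ) where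

  open TopCoefficient v l d top low high

  us : List ℕ
  us = upTo k

  weight : List X → ℤ
  weight xs = monomial v us xs * det (evenPowers v) xs us

  weightedMoment : ℕ → ℤ
  weightedMoment s = ∑ (power l k) (λ xs → total v xs ^ s * weight xs)

  weightedMoment-expand : ∀ s → weightedMoment s ≡ ∑ (alt k us) (λ w → momentSum k s (twist us w))
  weightedMoment-expand s = trans
    (∑-congOn (All.map (λ {(_ , xs)} len → begin
      total v xs ^ s * (monomial v us xs * ∑ (alt (length xs) us) (entries (evenPowers v) xs))
        ≡⟨ cong (λ n → total v xs ^ s * (monomial v us xs * ∑ (alt n us) (entries (evenPowers v) xs))) len ⟩
      total v xs ^ s * (monomial v us xs * ∑ (alt k us) (entries (evenPowers v) xs))
        ≡⟨ cong (total v xs ^ s *_) (∑-* (alt k us) (monomial v us xs) _) ⟨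
      total v xs ^ s * ∑ (alt k us) (λ w → monomial v us xs * entries (evenPowers v) xs w)
        ≡⟨ ∑-* (alt k us) (total v xs ^ s) _ ⟨
      ∑ (alt k us) (λ w → total v xs ^ s * (monomial v us xs * entries (evenPowers v) xs w))
        ≡⟨ ∑-congOn (All.map (λ {(_ , w)} len′ → cong (total v xs ^ s *_)
             (monomial-twist v us w xs len′ (trans len (sym (List.length-upTo k))))) (alt-length k us)) ⟩
      ∑ (alt k us) (λ w → total v xs ^ s * monomial v (twist us w) xs) ∎) (power-length l k)))
    (∑-swap (power l k) (alt k us) _)

  -- Permuting the column indices keeps their sum, so all Leibniz terms have the same degree and the
  -- low and exact cases apply to them uniformly.
  degrees : On (λ w → length (twist us w) ≡ k × sum (twist us w) ≡ 3 ℕ.* sum us) (alt k us)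
  degrees = All.zipWith (λ {(_ , w)} (len , sm) →
      trans (length-twist us w len) (List.length-upTo k) ,
      trans (sum-twist us w len) (trans (cong (λ z → 2 ℕ.* z ℕ.+ sum us) sm) (lem (sum us))))
    (alt-length k us , alt-sum k us)
    where
    lem : ∀ x → 2 ℕ.* x ℕ.+ x ≡ 3 ℕ.* x
    lem = ℕ-Solver.solve-∀

  weightedMoment-low : ∀ s → s ℕ.+ 3 ℕ.* sum us < k ℕ.* d → weightedMoment s ≡ 0ℤ
  weightedMoment-low s h = trans (weightedMoment-expand s) (∑-zero (All.map (λ {(_ , w)} (len , sm) →
    subst (λ n → momentSum n s (twist us w) ≡ 0ℤ) len (momentSum-low s (twist us w)
      (subst₂ _<_ (cong (s ℕ.+_) (sym sm)) (cong (ℕ._* d) (sym len)) h))) degrees))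

  -- The permutations recombine into the determinant with entries `falling d (2j + e)`. Pulling
  -- `falling d (2j)` out of column j leaves a Newton matrix, to which `det-newton` applies.
  weightedMoment-exact : ∀ s → s ℕ.+ 3 ℕ.* sum us ≡ k ℕ.* d → weightedMoment s * falling d d ^ k ≡
    + (s !) * (top ^ k * (∏ (λ j → falling d (2 ℕ.* j)) us * vandermonde (map (λ j → + d - + (2 ℕ.* j)) us)))
  weightedMoment-exact s h = begin
    weightedMoment s * F
      ≡⟨ trans (cong (_* F) (weightedMoment-expand s)) (trans (ℤ.*-comm _ F) (sym (∑-* (alt k us) F _))) ⟩
    ∑ (alt k us) (λ w → F * momentSum k s (twist us w))
      ≡⟨ ∑-congOn (All.zipWith (λ {(_ , w)} (len , len′ , sm) → begin
           F * momentSum k s (twist us w)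
             ≡⟨ ℤ.*-comm F _ ⟩
           momentSum k s (twist us w) * F
             ≡⟨ subst (λ n → momentSum n s (twist us w) * falling d d ^ n ≡
                               + (s !) * (top ^ n * ∏ (falling d) (twist us w))) len′
                  (momentSum-exact s (twist us w) (trans (cong (s ℕ.+_) sm) (trans h (cong (ℕ._* d) (sym len′))))) ⟩
           + (s !) * (top ^ k * ∏ (falling d) (twist us w))
             ≡⟨ cong (λ z → + (s !) * (top ^ k * z)) (∏-falling-twist d us w len) ⟩
           + (s !) * (top ^ k * entries E us w)
             ≡⟨ ℤ.*-assoc (+ (s !)) (top ^ k) _ ⟨
           + (s !) * top ^ k * entries E us w ∎)
         (alt-length k us , degrees)) ⟩
    ∑ (alt k us) (λ w → + (s !) * top ^ k * entries E us w)
      ≡⟨ trans (∑-* (alt k us) (+ (s !) * top ^ k) (entries E us)) (ℤ.*-assoc (+ (s !)) (top ^ k) _) ⟩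
    + (s !) * (top ^ k * ∑ (alt k us) (entries E us))
      ≡⟨ cong (λ n → + (s !) * (top ^ k * ∑ (alt n us) (entries E us))) (List.length-upTo k) ⟨
    + (s !) * (top ^ k * det E us us)
      ≡⟨ cong (λ z → + (s !) * (top ^ k * z)) (begin
           det E us us
             ≡⟨ det-scale-cols (λ j → falling d (2 ℕ.* j)) (λ e j → newton +_ e (node j)) us us refl ⟩
           ∏ (λ j → falling d (2 ℕ.* j)) us * det (λ e j → newton +_ e (node j)) us us
             ≡⟨ cong (∏ (λ j → falling d (2 ℕ.* j)) us *_) (begin
                  det (λ e j → newton +_ e (node j)) us us
                    ≡⟨ det-map-cols (newton (λ i → + i)) node us us ⟨
                  det (newton (λ i → + i)) us (map node us)
                    ≡⟨ det-newton k +_ (map node us) (trans (List.length-map node us) (List.length-upTo k)) ⟩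
                  vandermonde (map node us) ∎) ⟩
           ∏ (λ j → falling d (2 ℕ.* j)) us * vandermonde (map node us) ∎) ⟩
    + (s !) * (top ^ k * (∏ (λ j → falling d (2 ℕ.* j)) us * vandermonde (map node us))) ∎
    where
    F : ℤ
    F = falling d d ^ k
    node : ℕ → ℤ
    node j = + d - + (2 ℕ.* j)
    E : ℕ → ℕ → ℤ
    E e j = falling d (2 ℕ.* j) * newton +_ e (node j)

-- The relation is kept apart from equality of values so that atoms can be compared by index while
-- their squares enter the determinant.
vandermonde-repeated : ∀ {X : Set} {_∼_ : X → X → Set} → (∀ x y → Dec (x ∼ y)) →
  (f : X → ℤ) → (∀ {x y} → x ∼ y → f x ≡ f y) →
  ∀ xs → AllPairs (λ x y → ¬ (x ∼ y)) xs ⊎ vandermonde (map f xs) ≡ 0ℤ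
vandermonde-repeated _∼?_ f resp [] = inj₁ []
vandermonde-repeated {_∼_ = _∼_} _∼?_ f resp (x ∷ xs) with Any.any? (x ∼?_) xs
... | yes any = inj₂ (cong (_* vandermonde (map f xs)) (zeroFactor xs any))
  where
  zeroFactor : ∀ ys → Any (x ∼_) ys → ∏ (_- f x) (map f ys) ≡ 0ℤ
  zeroFactor (y ∷ ys) (here x∼y) =
    cong (_* ∏ (_- f x) (map f ys)) (trans (cong (_- f x) (sym (resp x∼y))) (ℤ.+-inverseʳ (f x)))
  zeroFactor (y ∷ ys) (there any) =
    trans (cong ((f y - f x) *_) (zeroFactor ys any)) (ℤ.*-zeroʳ (f y - f x))
... | no ¬any with vandermonde-repeated _∼?_ f resp xs
...   | inj₁ pairs = inj₁ (All.¬Any⇒All¬ xs ¬any ∷ pairs)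
...   | inj₂ vanishes = inj₂ (trans (cong (∏ (_- f x) (map f xs) *_) vanishes) (ℤ.*-zeroʳ (∏ (_- f x) (map f xs))))

-- Divisibility by p

∣-+ : ∀ {p x y} → + p ∣ x → + p ∣ y → + p ∣ x + y
∣-+ {p} {x} {y} h k = Signed.∣⇒∣ᵤ (Signed.∣m∣n⇒∣m+n (Signed.∣ᵤ⇒∣ {+ p} {x} h) (Signed.∣ᵤ⇒∣ {+ p} {y} k))

∣-*ˡ : ∀ {p} x {y} → + p ∣ y → + p ∣ x * y
∣-*ˡ {p} x {y} h = Signed.∣⇒∣ᵤ (Signed.∣n⇒∣m*n x (Signed.∣ᵤ⇒∣ {+ p} {y} h))

∣-*ʳ : ∀ {p x} y → + p ∣ x → + p ∣ x * y
∣-*ʳ {p} {x} y h = Signed.∣⇒∣ᵤ (Signed.∣m⇒∣m*n y (Signed.∣ᵤ⇒∣ {+ p} {x} h))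

∣-0 : ∀ {p} → + p ∣ 0ℤ
∣-0 {p} = p ℕ.∣0

∣-∑ : ∀ {A : Set} {p} {f : A → ℤ} {l} → On (λ a → + p ∣ f a) l → + p ∣ ∑ l f
∣-∑ {p = p} [] = ∣-0 {p}
∣-∑ {f = f} {l = (w , a) ∷ l} (h ∷ hs) = ∣-+ {x = w * f a} (∣-*ˡ w {f a} h) (∣-∑ hs)

∣-∏ : ∀ {A : Set} {p} {g : A → ℤ} {xs} → Any (λ x → + p ∣ g x) xs → + p ∣ ∏ g xs
∣-∏ {g = g} {xs = x ∷ xs} (here h) = ∣-*ʳ {x = g x} (∏ g xs) h
∣-∏ {g = g} {xs = x ∷ xs} (there h) = ∣-*ˡ (g x) {∏ g xs} (∣-∏ h)

module Nondivisibility {p : ℕ} (p-prime : Prime p) where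

  infix 4 p∤_

  p∤_ : ℤ → Set
  p∤ x = ¬ (+ p ∣ x)

  ∤-* : ∀ x y → p∤ x → p∤ y → p∤ x * y
  ∤-* x y p∤x p∤y p∣xy
    with euclidsLemma Data.Integer.∣ x ∣ Data.Integer.∣ y ∣ p-prime (subst (p ℕ.∣_) (ℤ.abs-* x y) p∣xy)
  ... | inj₁ p∣x = p∤x p∣x
  ... | inj₂ p∣y = p∤y p∣y

  ∤-pos : ∀ n → 0 < n → n < p → p∤ + n
  ∤-pos (suc n) _ n<p = ℕ.>⇒∤ n<p

  ∤-1 : p∤ 1ℤ
  ∤-1 = ∤-pos 1 (s≤s z≤n) (ℕ.nonTrivial⇒n>1 p {{prime⇒nonTrivial p-prime}})

  ∤-^ : ∀ x n → p∤ x → p∤ x ^ n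
  ∤-^ x zero _ = ∤-1
  ∤-^ x (suc n) h = ∤-* x (x ^ n) h (∤-^ x n h)

  ∤-∏ : ∀ {A : Set} {g : A → ℤ} {xs} → All (λ x → p∤ g x) xs → p∤ ∏ g xs
  ∤-∏ [] = ∤-1
  ∤-∏ {g = g} {x ∷ xs} (h ∷ hs) = ∤-* (g x) (∏ g xs) h (∤-∏ hs)

  ∤-! : ∀ n → n < p → p∤ + (n !)
  ∤-! zero _ = ∤-1
  ∤-! (suc n) h = subst p∤_ (sym (ℤ.pos-* (suc n) (n !)))
    (∤-* (+ suc n) (+ (n !)) (∤-pos (suc n) (s≤s z≤n) h) (∤-! n (ℕ.<⇒≤ h)))

  ∤-falling : ∀ {d} e → e ≤ d → d < p → p∤ falling d e
  ∤-falling zero _ _ = ∤-1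
  ∤-falling {d} (suc e) e<d d<p = subst p∤_ (sym (falling-suc d e))
    (∤-* (falling d e) (+ d - + e) (∤-falling e (ℕ.<⇒≤ e<d) d<p)
      (subst p∤_ (sym (trans (ℤ.m-n≡m⊖n d e) (ℤ.⊖-≥ (ℕ.<⇒≤ e<d))))
        (∤-pos (d ℕ.∸ e) (ℕ.m<n⇒0<n∸m e<d) (ℕ.≤-<-trans (ℕ.m∸n≤m d e) d<p))))

  ∤-vandermonde : ∀ {hs} → AllPairs (λ g h → p∤ h - g) hs → p∤ vandermonde hs
  ∤-vandermonde [] = ∤-1
  ∤-vandermonde {g ∷ hs} (a ∷ as) = ∤-* (∏ (_- g) hs) (vandermonde hs) (∤-∏ a) (∤-vandermonde as)

-- Signed sums and their residues

-- An element ±aᵢ of B is kept as a formal index and sign, so that repetition of an index does not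
-- depend on the integers `a i`.
Atom : ℕ → Set
Atom n = Fin n × Bool

value : ∀ {n} → (Fin n → ℤ) → Atom n → ℤ
value a (i , true) = a i
value a (i , false) = - a i

value²-index : ∀ {n} (a : Fin n → ℤ) {x y : Atom n} → proj₁ x ≡ proj₁ y → value a x * value a x ≡ value a y * value a y
value²-index a {i , true} {_ , true} refl = refl
value²-index a {i , true} {_ , false} refl = lem (a i)
  where
  lem : ∀ z → z * z ≡ - z * - z
  lem = solve-∀
value²-index a {i , false} {_ , true} refl = lem (a i)
  where
  lem : ∀ z → - z * - z ≡ z * z
  lem = solve-∀
value²-index a {i , false} {_ , false} refl = refl

signs : List Bool
signs = true ∷ false ∷ []

signs-complete : ∀ s → s ∈ signs
signs-complete true = here refl
signs-complete false = there (here refl)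

atoms : ∀ n → List (Atom n)
atoms n = cartesianProduct (allFin n) signs

∈-atoms : ∀ {n} (x : Atom n) → x ∈ atoms n
∈-atoms (i , s) = List.∈-cartesianProduct⁺ (List.∈-allFin i) (signs-complete s)

length-atoms : ∀ n → length (atoms n) ≡ 2 ℕ.* n
length-atoms n = trans (go (allFin n)) (cong (2 ℕ.*_) (List.length-tabulate {n = n} id))
  where
  go : ∀ (xs : List (Fin n)) → length (cartesianProduct xs signs) ≡ 2 ℕ.* length xs
  go [] = refl
  go (x ∷ xs) = trans (cong (λ m → suc (suc m)) (go xs)) (lem (length xs))
    where
    lem : ∀ m → suc (suc (2 ℕ.* m)) ≡ 2 ℕ.* suc m
    lem = ℕ-Solver.solve-∀

atoms-unique : ∀ n → Unique (atoms n)
atoms-unique n = Unique.cartesianProduct⁺ (Unique.allFin⁺ n) (((λ ()) ∷ []) ∷ [] ∷ [])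

insert : ∀ {n} → Fin n → Subset n → Subset n
insert i I = I Vec.[ i ]≔ inside

∣insert∣ : ∀ {n} (i : Fin n) I → Vec.lookup I i ≡ outside → ∣ insert i I ∣ ≡ suc ∣ I ∣
∣insert∣ Fin.zero (outside ∷ I) _ = refl
∣insert∣ (Fin.suc i) (outside ∷ I) h = ∣insert∣ i I h
∣insert∣ (Fin.suc i) (inside ∷ I) h = cong suc (∣insert∣ i I h)

-- `signedSum` chooses the sign by a local function; this rewrites that choice in terms of `value`.
signedSum-inside : ∀ {n} (I : Subset n) ε a →
  signedSum (inside ∷ I) ε a ≡ value a (Fin.zero , ε Fin.zero) + signedSum I (ε ∘ Fin.suc) (a ∘ Fin.suc)
signedSum-inside I ε a with ε Fin.zero
... | true = refl
... | false = refl

value-suc : ∀ {n} (a : Fin (suc n) → ℤ) i s → value (a ∘ Fin.suc) (i , s) ≡ value a (Fin.suc i , s)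
value-suc a i true = refl
value-suc a i false = refl

signedSum-insert : ∀ {n} (i : Fin n) s I ε a → Vec.lookup I i ≡ outside →
  signedSum (insert i I) (updateAt ε i (const s)) a ≡ value a (i , s) + signedSum I ε a
signedSum-insert Fin.zero s (outside ∷ I) ε a _ = signedSum-inside I (updateAt ε Fin.zero (const s)) a
signedSum-insert (Fin.suc i) s (outside ∷ I) ε a h =
  trans (signedSum-insert i s I (ε ∘ Fin.suc) (a ∘ Fin.suc) h)
    (cong (_+ signedSum I (ε ∘ Fin.suc) (a ∘ Fin.suc)) (value-suc a i s))
signedSum-insert (Fin.suc i) s (inside ∷ I) ε a h = begin
  signedSum (inside ∷ insert i I) (updateAt ε (Fin.suc i) (const s)) a
    ≡⟨ signedSum-inside (insert i I) (updateAt ε (Fin.suc i) (const s)) a ⟩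
  z + signedSum (insert i I) (updateAt (ε ∘ Fin.suc) i (const s)) (a ∘ Fin.suc)
    ≡⟨ cong (_+_ z) (trans (signedSum-insert i s I (ε ∘ Fin.suc) (a ∘ Fin.suc) h) (cong (_+ S) (value-suc a i s))) ⟩
  z + (value a (Fin.suc i , s) + S)
    ≡⟨ lem z (value a (Fin.suc i , s)) S ⟩
  value a (Fin.suc i , s) + (z + S)
    ≡⟨ cong (_+_ (value a (Fin.suc i , s))) (signedSum-inside I ε a) ⟨
  value a (Fin.suc i , s) + signedSum (inside ∷ I) ε a ∎
  where
  S : ℤ
  S = signedSum I (ε ∘ Fin.suc) (a ∘ Fin.suc)
  z : ℤ
  z = value a (Fin.zero , ε Fin.zero)
  lem : ∀ x y w → x + (y + w) ≡ y + (x + w)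
  lem = solve-∀

DistinctIndices : ∀ {n} → List (Atom n) → Set
DistinctIndices = AllPairs (λ x y → proj₁ x ≢ proj₁ y)

signedSum-∅ : ∀ {n} ε (a : Fin n → ℤ) → signedSum ∅ ε a ≡ 0ℤ
signedSum-∅ {zero} ε a = refl
signedSum-∅ {suc n} ε a = signedSum-∅ (ε ∘ Fin.suc) (a ∘ Fin.suc)

record Realisation {n : ℕ} (a : Fin n → ℤ) (xs : List (Atom n)) : Set where
  field
    support : Subset n
    signing : Fin n → Bool
    size : ∣ support ∣ ≡ length xs
    value-sum : signedSum support signing a ≡ total (value a) xs
    -- Strengthens the induction: the next index can be inserted only if it lies outside the support
    -- built so far.
    fresh : ∀ i → All (λ x → i ≢ proj₁ x) xs → Vec.lookup support i ≡ outside

realise : ∀ {n} (a : Fin n → ℤ) xs → DistinctIndices xs → Realisation a xs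
realise {n} a [] [] = record
  { support = ∅
  ; signing = const true
  ; size = Subset.∣⊥∣≡0 n
  ; value-sum = signedSum-∅ (const true) a
  ; fresh = λ i _ → Vec.lookup-replicate i outside
  }
realise a ((i , s) ∷ xs) (i∉xs ∷ distinct) = record
  { support = insert i support
  ; signing = updateAt signing i (const s)
  ; size = trans (∣insert∣ i support i∉I) (cong suc size)
  ; value-sum = trans (signedSum-insert i s support signing a i∉I) (cong (_+_ (value a (i , s))) value-sum)
  ; fresh = λ { j (j≢i ∷ j∉xs) → trans (Vec.lookup∘updateAt′ j i j≢i support) (fresh j j∉xs) }
  }
  where
  open Realisation (realise a xs distinct)
  i∉I : Vec.lookup support i ≡ outside
  i∉I = fresh i i∉xs

residue : ∀ p .{{_ : NonZero p}} → ℤ → Fin p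
residue p x = Fin.fromℕ< (n%ℕd<d x p)

residue-spec : ∀ p .{{_ : NonZero p}} x → x ≡[mod p ] (+ Fin.toℕ (residue p x))
residue-spec p x = Signed.∣⇒∣ᵤ {+ p} (Signed.divides (x /ℕ p) (begin
  x - + Fin.toℕ (residue p x)
    ≡⟨ cong (λ r → x - + r) (Fin.toℕ-fromℕ< (n%ℕd<d x p)) ⟩
  x - + (x %ℕ p)
    ≡⟨ cong (_- + (x %ℕ p)) (a≡a%ℕn+[a/ℕn]*n x p) ⟩
  + (x %ℕ p) + (x /ℕ p) * + p - + (x %ℕ p)
    ≡⟨ lem (+ (x %ℕ p)) ((x /ℕ p) * + p) ⟩
  (x /ℕ p) * + p ∎))
  where
  lem : ∀ r q → r + q - r ≡ q
  lem = solve-∀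

tuples : ∀ {A : Set} → List A → ℕ → List (List A)
tuples xs zero = [] ∷ []
tuples xs (suc k) = cartesianProductWith _∷_ xs (tuples xs k)

∈-tuples : ∀ {A : Set} {xs : List A} → (∀ x → x ∈ xs) → ∀ ws → ws ∈ tuples xs (length ws)
∈-tuples full [] = here refl
∈-tuples full (w ∷ ws) = List.∈-cartesianProductWith⁺ _∷_ (full w) (∈-tuples full ws)

tuples-length : ∀ {A : Set} (xs : List A) k {ws} → ws ∈ tuples xs k → length ws ≡ k
tuples-length xs zero (here refl) = refl
tuples-length xs (suc k) h with List.∈-cartesianProductWith⁻ _∷_ xs (tuples xs k) h
... | _ , _ , _ , ws∈ , refl = cong suc (tuples-length xs k ws∈)

lookup-injective : ∀ {A : Set} {xs : List A} → Unique xs → ∀ i j → lookup xs i ≡ lookup xs j → i ≡ j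
lookup-injective (_ ∷ _) Fin.zero Fin.zero _ = refl
lookup-injective (x∉ ∷ _) Fin.zero (Fin.suc j) e = contradiction e (All.lookup x∉ (List.∈-lookup j))
lookup-injective (x∉ ∷ _) (Fin.suc i) Fin.zero e = contradiction (sym e) (All.lookup x∉ (List.∈-lookup i))
lookup-injective (_ ∷ u) (Fin.suc i) (Fin.suc j) e = cong Fin.suc (lookup-injective u i j e)

-- After removing duplicates, either more than m residues remain and their positions give the
-- injection, or all of them fit into a list of length m.
large-or-listed : ∀ {p m} (S : Fin p → Set) (rs : List (Fin p)) → (∀ {r} → r ∈ rs → S r) →
  CardGreaterThan p S m ⊎ ∃ λ cs → length cs ≡ m × (∀ {r} → r ∈ rs → + Fin.toℕ r ∈ cs)
large-or-listed {p} {m} S rs holds with ℕ.<-≤-connex m (length (deduplicate Fin._≟_ rs))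
... | inj₁ m< = inj₁
  ( (λ j → lookup ds (Fin.inject≤ j m<))
  , (λ {i} {j} e → Fin.inject≤-injective m< m< i j (lookup-injective (deduplicate-! Fin._≟_ rs) _ _ e))
  , (λ j → holds (List.∈-deduplicate⁻ Fin._≟_ rs (List.∈-lookup (Fin.inject≤ j m<)))))
  where
  ds : List (Fin p)
  ds = deduplicate Fin._≟_ rs
... | inj₂ ≤m = inj₂
  ( map toℤ ds ++ replicate (m ℕ.∸ length ds) 0ℤ
  , trans (List.length-++ (map toℤ ds)) (trans (cong₂ ℕ._+_ (List.length-map toℤ ds) (List.length-replicate _))
      (ℕ.m+[n∸m]≡n ≤m))
  , (λ r∈ → List.∈-++⁺ˡ (List.∈-map⁺ toℤ (List.∈-deduplicate⁺ Fin._≟_ r∈))))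
  where
  ds : List (Fin p)
  ds = deduplicate Fin._≟_ rs
  toℤ : Fin p → ℤ
  toℤ r = + Fin.toℕ r

-- Arithmetic of the bound

sum-upTo : ∀ k → sum (upTo k) ≡ k C 2
sum-upTo zero = refl
sum-upTo (suc k) = begin
  sum (upTo (suc k))                ≡⟨ cong sum (List.upTo-∷ʳ k) ⟨
  sum (upTo k ++ k ∷ [])            ≡⟨ ListAction.sum-++ (upTo k) (k ∷ []) ⟩
  sum (upTo k) ℕ.+ (k ℕ.+ 0)        ≡⟨ cong₂ ℕ._+_ (sum-upTo k) (ℕ.+-identityʳ k) ⟩
  k C 2 ℕ.+ k                       ≡⟨ ℕ.+-comm (k C 2) k ⟩
  k ℕ.+ k C 2                       ≡⟨ cong (ℕ._+ k C 2) (nC1≡n k) ⟨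
  k C 1 ℕ.+ k C 2                   ≡⟨ nCk+nC[k+1]≡[n+1]C[k+1] k 1 ⟩
  suc k C 2                         ∎

C2-suc : ∀ k → suc k C 2 ≡ k ℕ.+ k C 2
C2-suc k = trans (sym (nCk+nC[k+1]≡[n+1]C[k+1] k 1)) (cong (ℕ._+ k C 2) (nC1≡n k))

2*C2 : ∀ k → 2 ℕ.* (k C 2) ℕ.+ k ≡ k ℕ.* k
2*C2 zero = refl
2*C2 (suc k) = begin
  2 ℕ.* (suc k C 2) ℕ.+ suc k               ≡⟨ cong (λ z → 2 ℕ.* z ℕ.+ suc k) (C2-suc k) ⟩
  2 ℕ.* (k ℕ.+ k C 2) ℕ.+ suc k             ≡⟨ lem₁ k (k C 2) ⟩
  2 ℕ.* (k C 2) ℕ.+ k ℕ.+ suc (2 ℕ.* k)     ≡⟨ cong (ℕ._+ suc (2 ℕ.* k)) (2*C2 k) ⟩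
  k ℕ.* k ℕ.+ suc (2 ℕ.* k)                 ≡⟨ lem₂ k ⟩
  suc k ℕ.* suc k                           ∎
  where
  lem₁ : ∀ k c → 2 ℕ.* (k ℕ.+ c) ℕ.+ suc k ≡ 2 ℕ.* c ℕ.+ k ℕ.+ suc (2 ℕ.* k)
  lem₁ = ℕ-Solver.solve-∀
  lem₂ : ∀ k → k ℕ.* k ℕ.+ suc (2 ℕ.* k) ≡ suc k ℕ.* suc k
  lem₂ = ℕ-Solver.solve-∀

-- Writing n as k + t removes the truncated subtraction.
bound-+ : ∀ k t → bound (k ℕ.+ t) k ≡ 2 ℕ.* k ℕ.* t ℕ.+ (k ℕ.+ k C 2)
bound-+ k t = cong₂ (λ x y → 2 ℕ.* k ℕ.* x ℕ.+ y) (ℕ.m+n∸m≡n k t) (C2-suc k)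

-- This identity is the origin of the bound: m is the degree left for powers of S beside the weight.
-- Adding k to both sides allows the use of 2 C(k,2) + k = k² without subtraction.
bound-degree : ∀ k n d → k ≤ n → suc d ≡ 2 ℕ.* n → bound n k ℕ.+ 3 ℕ.* sum (upTo k) ≡ k ℕ.* d
bound-degree k n d k≤n hd with ℕ.m≤n⇒∃[o]m+o≡n k≤n
... | t , refl = ℕ.+-cancelʳ-≡ k _ _ (begin
  bound (k ℕ.+ t) k ℕ.+ 3 ℕ.* sum (upTo k) ℕ.+ k
    ≡⟨ cong₂ (λ x y → x ℕ.+ 3 ℕ.* y ℕ.+ k) (bound-+ k t) (sum-upTo k) ⟩
  2 ℕ.* k ℕ.* t ℕ.+ (k ℕ.+ k C 2) ℕ.+ 3 ℕ.* (k C 2) ℕ.+ k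
    ≡⟨ lem₁ k t (k C 2) ⟩
  2 ℕ.* k ℕ.* t ℕ.+ 2 ℕ.* (2 ℕ.* (k C 2) ℕ.+ k)
    ≡⟨ cong (λ z → 2 ℕ.* k ℕ.* t ℕ.+ 2 ℕ.* z) (2*C2 k) ⟩
  2 ℕ.* k ℕ.* t ℕ.+ 2 ℕ.* (k ℕ.* k)
    ≡⟨ lem₂ k t ⟩
  k ℕ.* (2 ℕ.* (k ℕ.+ t))
    ≡⟨ cong (k ℕ.*_) hd ⟨
  k ℕ.* suc d
    ≡⟨ lem₃ k d ⟩
  k ℕ.* d ℕ.+ k ∎)
  where
  lem₁ : ∀ k t c → 2 ℕ.* k ℕ.* t ℕ.+ (k ℕ.+ c) ℕ.+ 3 ℕ.* c ℕ.+ k ≡ 2 ℕ.* k ℕ.* t ℕ.+ 2 ℕ.* (2 ℕ.* c ℕ.+ k)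
  lem₁ = ℕ-Solver.solve-∀
  lem₂ : ∀ k t → 2 ℕ.* k ℕ.* t ℕ.+ 2 ℕ.* (k ℕ.* k) ≡ k ℕ.* (2 ℕ.* (k ℕ.+ t))
  lem₂ = ℕ-Solver.solve-∀
  lem₃ : ∀ k d → k ℕ.* suc d ≡ k ℕ.* d ℕ.+ k
  lem₃ = ℕ-Solver.solve-∀

-- Serves to deduce d < p from the hypothesis on p; for k = 1 it is an equality.
degree≤bound : ∀ k n d → 1 ≤ k → k ≤ n → suc d ≡ 2 ℕ.* n → d ≤ bound n k
degree≤bound (suc k) n d _ k≤n hd with ℕ.m≤n⇒∃[o]m+o≡n k≤n
... | t , refl = subst₂ _≤_ (ℕ.suc-injective (trans (lem₁ k t) (sym hd)))
  (sym (trans (bound-+ (suc k) t) (trans (cong (λ c → 2 ℕ.* suc k ℕ.* t ℕ.+ (suc k ℕ.+ c)) (C2-suc k)) (lem₂ k t (k C 2)))))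
  (ℕ.m≤m+n (suc (2 ℕ.* k ℕ.+ 2 ℕ.* t)) (2 ℕ.* k ℕ.* t ℕ.+ k C 2))
  where
  lem₁ : ∀ k t → suc (suc (2 ℕ.* k ℕ.+ 2 ℕ.* t)) ≡ 2 ℕ.* (suc k ℕ.+ t)
  lem₁ = ℕ-Solver.solve-∀
  lem₂ : ∀ k t c → 2 ℕ.* suc k ℕ.* t ℕ.+ (suc k ℕ.+ (k ℕ.+ c)) ≡ suc (2 ℕ.* k ℕ.+ 2 ℕ.* t) ℕ.+ (2 ℕ.* k ℕ.* t ℕ.+ c)
  lem₂ = ℕ-Solver.solve-∀

-- Nonvanishing modulo p and the contradiction

value-distinct : ∀ {p n} (a : Fin n → ℤ) →
  (∀ i j → i ≢ j → ¬ (a i ≡[mod p ] a j)) → (∀ i j → ¬ ((a i + a j) ≡[mod p ] (+ 0))) →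
  ∀ {x y} → x ≢ y → ¬ (+ p ∣ value a y - value a x)
value-distinct a a≢ a+≢ {i , true} {j , true} x≢y = a≢ j i (λ { refl → x≢y refl })
-- Opposite signs lead to a sum `a i + a j`; the case i = j is included and separates aᵢ from -aᵢ.
value-distinct {p} a a≢ a+≢ {i , true} {j , false} x≢y h =
  a+≢ i j (subst (+ p ∣_) (lem (a i) (a j)) (∣-*ˡ -1ℤ {value a (j , false) - value a (i , true)} h))
  where
  lem : ∀ x y → -1ℤ * (- y - x) ≡ x + y - + 0
  lem = solve-∀
value-distinct {p} a a≢ a+≢ {i , false} {j , true} x≢y h = a+≢ j i (subst (+ p ∣_) (lem (a i) (a j)) h)
  where
  lem : ∀ x y → y - - x ≡ y + x - + 0
  lem = solve-∀
value-distinct {p} a a≢ a+≢ {i , false} {j , false} x≢y h =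
  a≢ i j (λ { refl → x≢y refl }) (subst (+ p ∣_) (lem (a i) (a j)) h)
  where
  lem : ∀ x y → - y - - x ≡ x - y
  lem = solve-∀

module Contradiction {p : ℕ} (p-prime : Prime p) (n′ k : ℕ) (1≤k : 1 ≤ k) (k≤n : k ≤ suc n′) (a : Fin (suc n′) → ℤ)
  (a≢ : ∀ i j → i ≢ j → ¬ (a i ≡[mod p ] a j)) (a+≢ : ∀ i j → ¬ ((a i + a j) ≡[mod p ] (+ 0)))
  (p>m : p > bound (suc n′) k) where

  open Nondivisibility p-prime

  v : Atom (suc n′) → ℤ
  v = value a

  x₀ : Atom (suc n′)
  x₀ = Fin.zero , true

  rest : List (Atom (suc n′))
  -- `x₀ ∷ rest` reduces to `atoms (suc n′)`; the split is needed because `divDiff` takes its first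
  -- node separately.
  rest = drop 1 (atoms (suc n′))

  d m : ℕ
  d = length rest
  m = bound (suc n′) k

  open DividedDifference v
  open TwistedCoefficient v (divDiff x₀ rest) d (vandermonde (map v (x₀ ∷ rest)))
    (moment-low x₀ rest) (moment-top x₀ rest) k

  suc-d : suc d ≡ 2 ℕ.* suc n′
  suc-d = length-atoms (suc n′)

  d<p : d < p
  d<p = ℕ.≤-<-trans (degree≤bound k (suc n′) d 1≤k k≤n suc-d) p>m

  m-exact : m ℕ.+ 3 ℕ.* sum us ≡ k ℕ.* d
  m-exact = bound-degree k (suc n′) d k≤n suc-d

  2j≤d : ∀ {j} → j < k → 2 ℕ.* j ≤ d
  2j≤d {j} j<k = ℕ.≤-pred (ℕ.≤-trans (ℕ.n≤1+n _) (subst₂ _≤_ (lem j) (sym suc-d)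
    (ℕ.*-monoʳ-≤ 2 (ℕ.≤-trans j<k k≤n))))
    where
    lem : ∀ j → 2 ℕ.* suc j ≡ suc (suc (2 ℕ.* j))
    lem = ℕ-Solver.solve-∀

  -- If p divided 2, then a₀ + a₀ would vanish. The size condition alone would admit p = 2 when n =
  -- k = 1.
  p∤2 : p∤ + 2
  p∤2 h = a+≢ Fin.zero Fin.zero (subst (+ p ∣_) (lem (a Fin.zero)) (∣-*ʳ {x = + 2} (a Fin.zero) h))
    where
    lem : ∀ x → + 2 * x ≡ x + x - + 0
    lem = solve-∀

  -- The difference is -2 (j - i), and 0 < j - i < k ≤ d + 1 ≤ p.
  node-distinct : ∀ {i j} → i < j → j < k → p∤ (+ d - + (2 ℕ.* j)) - (+ d - + (2 ℕ.* i))
  node-distinct {i} i<j j<k with ℕ.m≤n⇒∃[o]m+o≡n i<j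
  ... | t , refl = subst p∤_ (sym (trans
      (cong₂ (λ x y → (+ d - x) - (+ d - y)) (ℤ.pos-* 2 (suc (i ℕ.+ t))) (ℤ.pos-* 2 i))
      (lem (+ d) (+ i) (+ t))))
    (∤-* (- + 2) (+ suc t) p∤2
      (∤-pos (suc t) (s≤s z≤n) (ℕ.≤-<-trans (s≤s (ℕ.m≤n+m t i))
        (ℕ.<-≤-trans j<k (ℕ.≤-trans k≤1+d d<p)))))
    where
    lem : ∀ d i t → (d - + 2 * (1ℤ + (i + t))) - (d - + 2 * i) ≡ - + 2 * (1ℤ + t)
    lem = solve-∀
    k≤1+d : k ≤ suc d
    k≤1+d = ℕ.≤-trans k≤n (ℕ.≤-trans (ℕ.m≤n*m (suc n′) 2) (ℕ.≤-reflexive (sym suc-d)))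

  atoms-distinct : p∤ vandermonde (map v (x₀ ∷ rest))
  atoms-distinct = ∤-vandermonde (AllPairs.map⁺ {f = v} (AllPairs.map (λ {x} {y} → value-distinct a a≢ a+≢ {x} {y}) (atoms-unique (suc n′))))

  -- A multiple of the moment has an explicit value whose factors are all prime to p: m! since m <
  -- p, the falling factorials since 2j ≤ d < p, and both Vandermonde products since their entries
  -- are distinct modulo p.
  p∤weightedMoment : p∤ weightedMoment m
  p∤weightedMoment h = subst p∤_ (sym (weightedMoment-exact m m-exact))
    (∤-* (+ (m !)) _ (∤-! m p>m)
      (∤-* (vandermonde (map v (x₀ ∷ rest)) ^ k) _ (∤-^ _ k atoms-distinct)
        (∤-* (∏ (λ j → falling d (2 ℕ.* j)) us) _
          (∤-∏ (All.applyUpTo⁺₁ id k (λ {j} j<k → ∤-falling (2 ℕ.* j) (2j≤d j<k) d<p)))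
          (∤-vandermonde (AllPairs.map⁺ {f = λ j → + d - + (2 ℕ.* j)} (AllPairs.applyUpTo⁺₁ id k node-distinct))))))
    (∣-*ʳ {x = weightedMoment m} (falling d d ^ k) h)

  no-listing : ∀ cs → length cs ≡ m →
    ¬ (∀ xs → length xs ≡ k → DistinctIndices xs → Any (λ c → + p ∣ total v xs - c) cs)
  no-listing cs len listed = p∤weightedMoment (subst (+ p ∣_) located (∣-∑ (All.map
    (λ {(_ , xs)} → divisible xs) (power-length (divDiff x₀ rest) k))))
    where
    -- The factor `total v xs ^ 0` is the initial accumulator of `∑-locator`. Powers of S below m
    -- contribute nothing because they leave the degree below k d.
    located : ∑ (power (divDiff x₀ rest) k) (λ xs → ∏ (_-_ (total v xs)) cs * (total v xs ^ 0 * weight xs))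
      ≡ weightedMoment m
    located = trans
      (∑-locator (power (divDiff x₀ rest) k) (total v) weight m
        (λ r r<m → weightedMoment-low r (ℕ.<-≤-trans (ℕ.+-monoˡ-< (3 ℕ.* sum us) r<m) (ℕ.≤-reflexive m-exact)))
        cs 0 (ℕ.≤-reflexive (trans (ℕ.+-identityʳ _) len)))
      (cong weightedMoment (trans (ℕ.+-identityʳ _) len))
    divisible : ∀ xs → length xs ≡ k → + p ∣ ∏ (_-_ (total v xs)) cs * (total v xs ^ 0 * weight xs)
    divisible xs len-xs
      with vandermonde-repeated (λ x y → proj₁ x Fin.≟ proj₁ y) (λ x → v x * v x) (λ {x} {y} → value²-index a {x} {y}) xs
    ... | inj₁ distinct =
      ∣-*ʳ {x = ∏ (_-_ (total v xs)) cs} (total v xs ^ 0 * weight xs) (∣-∏ (listed xs len-xs distinct))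
    ... | inj₂ vanishes = subst (+ p ∣_) (sym (begin
        ∏ (_-_ (total v xs)) cs * (1ℤ * (monomial v us xs * det (evenPowers v) xs us))
          ≡⟨ cong (λ z → ∏ (_-_ (total v xs)) cs * (1ℤ * (monomial v us xs * z)))
               (trans (cong (λ j → det (evenPowers v) xs (upTo j)) (sym len-xs))
                 (trans (det-evenPowers v xs) vanishes)) ⟩
        ∏ (_-_ (total v xs)) cs * (1ℤ * (monomial v us xs * 0ℤ))
          ≡⟨ lem (∏ (_-_ (total v xs)) cs) (monomial v us xs) ⟩
        0ℤ ∎)) (∣-0 {p})
      where
      lem : ∀ x y → x * (1ℤ * (y * 0ℤ)) ≡ 0ℤ
      lem = solve-∀

theorem6p1 : (p n k : ℕ) → Prime p → 1 ≤ k → k ≤ n →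
    (a : Fin n → ℤ) →
    (∀ i j → i ≢ j → ¬ (a i ≡[mod p ] a j)) →
    (∀ i → ¬ (a i ≡[mod p ] (+ 0))) →
    (∀ i j → ¬ ((a i + a j) ≡[mod p ] (+ 0))) →
    p > bound n k →
    CardGreaterThan p (InSignedSumset p n k a) (bound n k)
theorem6p1 p zero (suc k) _ _ ()
theorem6p1 p (suc n′) k p-prime 1≤k k≤n a a≢ _ a+≢ p>m =
  case large-or-listed (InSignedSumset p (suc n′) k a) sums attained of λ
    { (inj₁ large) → large
    ; (inj₂ (cs , len , listed)) → contradiction
        (λ xs len-xs distinct → Any.map
          (λ {c} e → subst (λ z → + p ∣ total (value a) xs - z) e (residue-spec p (total (value a) xs)))
          (listed (complete xs len-xs distinct)))
        (Contradiction.no-listing p-prime n′ k 1≤k k≤n a a≢ a+≢ p>m cs len)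
    }
  where
  instance
    nonZero : NonZero p
    nonZero = prime⇒nonZero p-prime
  distinct? : ∀ xs → Dec (DistinctIndices {suc n′} xs)
  distinct? = AllPairs.allPairs? (λ x y → ¬? (proj₁ x Fin.≟ proj₁ y))
  sums : List (Fin p)
  -- Enumerating tuples of atoms gives directly the listing that `no-listing` refutes; `realise`
  -- turns each tuple back into a subset with signs.
  sums = map (residue p ∘ total (value a)) (filter distinct? (tuples (atoms (suc n′)) k))
  complete : ∀ xs → length xs ≡ k → DistinctIndices xs → residue p (total (value a) xs) ∈ sums
  complete xs refl distinct =
    List.∈-map⁺ (residue p ∘ total (value a)) (List.∈-filter⁺ distinct? (∈-tuples ∈-atoms xs) distinct)
  attained : ∀ {r} → r ∈ sums → InSignedSumset p (suc n′) k a r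
  attained r∈ with List.∈-map⁻ (residue p ∘ total (value a)) r∈
  ... | xs , xs∈ , refl with List.∈-filter⁻ distinct? {xs = tuples (atoms (suc n′)) k} xs∈
  ...   | xs∈tuples , distinct = support , signing , trans size (tuples-length (atoms (suc n′)) k xs∈tuples) ,
          subst (λ z → z ≡[mod p ] (+ Fin.toℕ (residue p (total (value a) xs)))) (sym value-sum)
            (residue-spec p (total (value a) xs))
    where
    open Realisation (realise a xs distinct)
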